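{- Let $n,s,k\ge 0$ be integers. There is an explicit bijection mapping the rook placements in $RC_k(n,s)$ to the tree-rooted maps with $n$ edges and vertex set of the form $\{s+1\}\cup V$, where $V\subset[s]$ and $\#V=k$ (the subset $V$ being allowed to vary over all $k$-element subsets of $[s]$).
   Context: Notation: $[m]=\{1,2,\ldots,m\}$. Boards and rook placements: $Y(n,s)$ is the set of integer sequences $\mu=(\mu_1,\ldots,\mu_n)$ with $s\le\mu_1\le\mu_2\le\cdots\le\mu_n\le s+n$; each is viewed as a left-justified board whose row $i$ (rows numbered from the top) consists of the squares in columns $1,\ldots,\mu_i$. A placement of $n$ non-attacking rooks on $\mu$ is a set of $n$ squares of $\mu$ with at most one in each row and at most one in each column. $RC(n,s)$ is the set of pairs $(\mu,C)$ with $\mu\in Y(n,s)$ and $C$ a placement of $n$ non-attacking rooks on $\mu$. $RC_k(n,s)\subset RC(n,s)$ is the subset of pairs $(\mu,C)$ for which exactly $k$ rooks of $C$ lie in the first $s$ columns. Maps: A map is an embedding, up to homeomorphism, of a connected graph (loops and multiple edges allowed) in a compact orientable surface such that the complement of the graph is a disjoint union of disks (any number of faces is allowed). A map is determined by its underlying graph together with its rotation system, i.e. the cyclic (counterclockwise) order of the half-edges around each vertex. A rooted map is given by a graph with a rooted rotation system: one vertex is designated as the root vertex, the half-edges around the root vertex are given a total order (compatible with the cyclic order, i.e. the cyclic order is broken at a chosen smallest half-edge), and the half-edges around every other vertex are given a cyclic order. A tree-rooted map is a rooted map together with a designated spanning tree of its underlying graph; the spanning tree is rooted at the root vertex of the map.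 Vertices are labeled by the given vertex set and any vertex may be the root vertex; edges and half-edges are unlabeled, so two such objects are identified when there is a bijection between their half-edges respecting incidence with the labeled vertices, the pairing of half-edges into edges, the root vertex, the cyclic/total orders, and the spanning tree. -}

module Defs where

open import Data.Nat.Base using (ℕ; suc; _+_; _*_; _≤_; _<_)
open import Data.Nat.GeneralisedArithmetic using (iterate)
open import Data.Fin.Base as Fin using (Fin; zero; suc; toℕ; fromℕ; inject₁)
open import Data.Fin.Permutation as Perm
  using (Permutation′; _⟨$⟩ʳ_; _⟨$⟩ˡ_; _∘ₚ_)
open import Data.Fin.Subset
  using (Subset; outside; _∈_; _∪_; ⁅_⁆; ⊤; ∣_∣)
open import Data.Maybe.Base as Maybe using (Maybe; just; nothing)
open import Data.Maybe.Properties using (map-id; map-cong; map-∘)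
open import Data.Product.Base using (Σ; ∃; ∃-syntax; _×_; _,_; proj₁)
open import Data.Vec.Base as Vec using (Vec; lookup; take; _∷ʳ_)
open import Function.Definitions using (Injective)
open import Level using (0ℓ)
open import Relation.Binary.Bundles using (Setoid)
open import Relation.Binary.Construct.Closure.ReflexiveTransitive using (Star)
import Relation.Binary.Construct.On as On
open import Relation.Binary.PropositionalEquality
  using (_≡_; _≢_; refl; sym; trans; cong; setoid; module ≡-Reasoning)
open import Relation.Nullary.Negation using (¬_)

------------------------------------------------------------------------
-- Boards and rook placements

-- The index i : Fin m stands for the element i + 1 of [m] throughout.

-- The entries of a member of Y(n,s) are at least s ≥ 0, so natural-number
-- sequences suffice.
record IsBoard (n s : ℕ) (μ : Vec ℕ n) : Set where
  field
    lower    : ∀ i → s ≤ lookup μ i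
    monotone : ∀ i j → i Fin.≤ j → lookup μ i ≤ lookup μ j
    upper    : ∀ i → lookup μ i ≤ s + n

-- A set of squares of the rectangle [n] × [m], given by the set of columns
-- occupied in each row.
Squares : ℕ → ℕ → Set
Squares n m = Vec (Subset m) n

∥_∥ : ∀ {n m} → Squares n m → ℕ
∥ C ∥ = Vec.sum (Vec.map ∣_∣ C)

-- All boards of Y(n,s) fit in the rectangle [n] × [s + n].
record IsRookPlacement {n m : ℕ} (μ : Vec ℕ n) (C : Squares n m) : Set where
  field
    onBoard   : ∀ i j → j ∈ lookup C i → toℕ j < lookup μ i
    rowwise   : ∀ i j j′ → j ∈ lookup C i → j′ ∈ lookup C i → j ≡ j′
    colwise   : ∀ i i′ j → j ∈ lookup C i → j ∈ lookup C i′ → i ≡ i′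
    rookCount : ∥ C ∥ ≡ n

record RC (n s : ℕ) : Set where
  field
    μ           : Vec ℕ n
    C           : Squares n (s + n)
    isBoard     : IsBoard n s μ
    isPlacement : IsRookPlacement μ C

rooksInFirstColumns : ∀ {n s} → RC n s → ℕ
rooksInFirstColumns {s = s} p = ∥ Vec.map (take s) (RC.C p) ∥

-- RC_k(n,s); elements are compared as pairs (μ , C), ignoring proofs.
RCₖ : (n s k : ℕ) → Setoid 0ℓ 0ℓ
RCₖ n s k =
  On.setoid {B = Σ (RC n s) λ p → rooksInFirstColumns p ≡ k}
            (setoid (Vec ℕ n × Squares n (s + n)))
            (λ (p , _) → RC.μ p , RC.C p)

------------------------------------------------------------------------
-- Graphs

-- A multigraph (loops allowed) with n edges and vertex set W ⊆ [N].  Its 2n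
-- half-edges are numbered arbitrarily; the numbering is forgotten by the
-- notion of isomorphism below.  An edge is an orbit {h , mate h}.
record Graph (n : ℕ) {N : ℕ} (W : Subset N) : Set where
  field
    end           : Fin (2 * n) → Fin N
    end-∈         : ∀ h → end h ∈ W
    mate          : Fin (2 * n) → Fin (2 * n)
    mate-mate     : ∀ h → mate (mate h) ≡ h
    mate-distinct : ∀ h → mate h ≢ h

module _ {n N : ℕ} {W : Subset N} (G : Graph n W) where
  open Graph G

  -- A set of edges is given as a set of half-edges closed under mate.
  IsEdgeSet : Subset (2 * n) → Set
  IsEdgeSet T = ∀ h → h ∈ T → mate h ∈ T

  Adjacent : Subset (2 * n) → Fin N → Fin N → Set
  Adjacent T u v = ∃[ h ] (h ∈ T × end h ≡ u × end (mate h) ≡ v)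

  -- Connectedness of the spanning subgraph (W , T).
  Connected : Subset (2 * n) → Set
  Connected T = ∀ u v → u ∈ W → v ∈ W → Star (Adjacent T) u v

  -- A cycle of length m + 1: the i-th edge is traversed from end (d i) to
  -- end (mate (d i)); vertices and edges are pairwise distinct.  A loop is a
  -- cycle of length 1 and two parallel edges form a cycle of length 2.
  record Cycle (T : Subset (2 * n)) (m : ℕ) : Set where
    field
      d              : Fin (suc m) → Fin (2 * n)
      d-∈            : ∀ i → d i ∈ T
      consecutive    : ∀ (i : Fin m) → end (mate (d (inject₁ i))) ≡ end (d (suc i))
      closed         : end (mate (d (fromℕ m))) ≡ end (d zero)
      vertexDistinct : Injective _≡_ _≡_ (λ i → end (d i))
      -- d i ≢ d j for i ≢ j follows from vertexDistinct
      edgeDistinct   : ∀ i j → d i ≢ mate (d j)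

  record IsSpanningTree (T : Subset (2 * n)) : Set where
    field
      isEdgeSet : IsEdgeSet T
      connected : Connected T
      acyclic   : ∀ m → ¬ Cycle T m

------------------------------------------------------------------------
-- Maps

-- A connected graph with a rotation system: next h is the half-edge following
-- h counterclockwise around its vertex, so that the cycles of next are exactly
-- the sets of half-edges around each vertex of positive degree.
record CombMap (n : ℕ) {N : ℕ} (W : Subset N) : Set where
  field
    graph     : Graph n W
    connected : Connected graph ⊤
    next      : Permutation′ (2 * n)
  open Graph graph public
  field
    next-end  : ∀ h → end (next ⟨$⟩ʳ h) ≡ end h
    next-full : ∀ h h′ → end h ≡ end h′ → ∃[ m ] iterate (next ⟨$⟩ʳ_) h m ≡ h′

-- A total order on the half-edges around the root compatible with their cyclic
-- order is the choice of a smallest half-edge; there is none to choose exactly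
-- when the root has degree 0.
IsFirstAt : ∀ {n N} {W : Subset N} → CombMap n W → Fin N → Maybe (Fin (2 * n)) → Set
IsFirstAt M r (just h) = CombMap.end M h ≡ r
IsFirstAt M r nothing  = ∀ h → CombMap.end M h ≢ r

record RootedMap (n : ℕ) {N : ℕ} (W : Subset N) : Set where
  field
    combMap : CombMap n W
    root    : Fin N
    root-∈  : root ∈ W
    first   : Maybe (Fin (2 * n))
    isFirst : IsFirstAt combMap root first
  open CombMap combMap public

record TreeRootedMap (n : ℕ) {N : ℕ} (W : Subset N) : Set where
  field
    rootedMap      : RootedMap n W
  open RootedMap rootedMap public
  field
    tree           : Subset (2 * n)
    isSpanningTree : IsSpanningTree graph tree

-- A bijection between the half-edges respecting all the structure; vertex
-- labels are kept fixed.
record Iso {n N : ℕ} {W W′ : Subset N}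
           (M : TreeRootedMap n W) (M′ : TreeRootedMap n W′) : Set where
  private
    module M  = TreeRootedMap M
    module M′ = TreeRootedMap M′
  field
    φ       : Permutation′ (2 * n)
    φ-end   : ∀ h → M′.end (φ ⟨$⟩ʳ h) ≡ M.end h
    φ-mate  : ∀ h → M′.mate (φ ⟨$⟩ʳ h) ≡ φ ⟨$⟩ʳ (M.mate h)
    φ-next  : ∀ h → M′.next ⟨$⟩ʳ (φ ⟨$⟩ʳ h) ≡ φ ⟨$⟩ʳ (M.next ⟨$⟩ʳ h)
    φ-root  : M′.root ≡ M.root
    φ-first : M′.first ≡ Maybe.map (φ ⟨$⟩ʳ_) M.first
    φ-tree  : ∀ h → lookup M′.tree (φ ⟨$⟩ʳ h) ≡ lookup M.tree h

module _ {n N : ℕ} where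

  Iso-refl : {W : Subset N} {M : TreeRootedMap n W} → Iso M M
  Iso-refl = record
    { φ = Perm.id
    ; φ-end = λ _ → refl ; φ-mate = λ _ → refl ; φ-next = λ _ → refl
    ; φ-root = refl ; φ-first = sym (map-id _) ; φ-tree = λ _ → refl }

  Iso-sym : {W W′ : Subset N} {M : TreeRootedMap n W} {M′ : TreeRootedMap n W′} →
            Iso M M′ → Iso M′ M
  Iso-sym {M = M} {M′} i = record
    { φ       = Perm.flip φ
    ; φ-end   = λ h → trans (sym (φ-end (ψ h))) (cong M′.end (φψ h))
    ; φ-mate  = transport M.mate M′.mate φ-mate
    ; φ-next  = transport (M.next ⟨$⟩ʳ_) (M′.next ⟨$⟩ʳ_) φ-next
    ; φ-root  = sym φ-root
    ; φ-first = sym (begin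
        Maybe.map ψ M′.first                       ≡⟨ cong (Maybe.map ψ) φ-first ⟩
        Maybe.map ψ (Maybe.map (φ ⟨$⟩ʳ_) M.first)  ≡⟨ map-∘ M.first ⟨
        Maybe.map (λ h → ψ (φ ⟨$⟩ʳ h)) M.first     ≡⟨ map-cong (λ _ → ψφ _) M.first ⟩
        Maybe.map (λ h → h) M.first                ≡⟨ map-id M.first ⟩
        M.first                                    ∎)
    ; φ-tree  = λ h → trans (sym (φ-tree (ψ h))) (cong (lookup M′.tree) (φψ h))
    }
    where
    open ≡-Reasoning
    open Iso i
    module M  = TreeRootedMap M
    module M′ = TreeRootedMap M′

    ψ : Fin (2 * n) → Fin (2 * n)
    ψ = φ ⟨$⟩ˡ_

    φψ : ∀ h → φ ⟨$⟩ʳ (ψ h) ≡ h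
    φψ h = Perm.inverseʳ φ

    ψφ : ∀ h → ψ (φ ⟨$⟩ʳ h) ≡ h
    ψφ h = Perm.inverseˡ φ

    transport : (f f′ : Fin (2 * n) → Fin (2 * n)) →
                (∀ h → f′ (φ ⟨$⟩ʳ h) ≡ φ ⟨$⟩ʳ (f h)) →
                ∀ h → f (ψ h) ≡ ψ (f′ h)
    transport f f′ eq h = begin
      f (ψ h)                  ≡⟨ ψφ (f (ψ h)) ⟨
      ψ (φ ⟨$⟩ʳ (f (ψ h)))     ≡⟨ cong ψ (eq (ψ h)) ⟨
      ψ (f′ (φ ⟨$⟩ʳ (ψ h)))    ≡⟨ cong (λ x → ψ (f′ x)) (φψ h) ⟩
      ψ (f′ h)                 ∎

  Iso-trans : {W W′ W″ : Subset N} {M : TreeRootedMap n W}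
              {M′ : TreeRootedMap n W′} {M″ : TreeRootedMap n W″} →
              Iso M M′ → Iso M′ M″ → Iso M M″
  Iso-trans {M = M} {M″ = M″} i j = record
    { φ       = I.φ ∘ₚ J.φ
    ; φ-end   = λ h → trans (J.φ-end _) (I.φ-end h)
    ; φ-mate  = λ h → trans (J.φ-mate _) (cong (J.φ ⟨$⟩ʳ_) (I.φ-mate h))
    ; φ-next  = λ h → trans (J.φ-next _) (cong (J.φ ⟨$⟩ʳ_) (I.φ-next h))
    ; φ-root  = trans J.φ-root I.φ-root
    ; φ-first = trans J.φ-first
                  (trans (cong (Maybe.map (J.φ ⟨$⟩ʳ_)) I.φ-first)
                         (sym (map-∘ (TreeRootedMap.first M))))
    ; φ-tree  = λ h → trans (J.φ-tree _) (I.φ-tree h)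
    }
    where
    module I = Iso i
    module J = Iso j

------------------------------------------------------------------------
-- Tree-rooted maps with n edges and vertex set {s + 1} ∪ V, V ⊂ [s], #V = k

-- The label s + 1 is the last element fromℕ s of Fin (suc s).
vertexSet : ∀ {s} → Subset s → Subset (suc s)
vertexSet {s} V = ⁅ fromℕ s ⁆ ∪ (V ∷ʳ outside)

record LabelledTreeRootedMap (n s k : ℕ) : Set where
  field
    V    : Subset s
    ∣V∣≡k : ∣ V ∣ ≡ k
    map  : TreeRootedMap n (vertexSet V)

TreeRootedMaps : (n s k : ℕ) → Setoid 0ℓ 0ℓ
TreeRootedMaps n s k = record
  { Carrier       = LabelledTreeRootedMap n s k
  ; _≈_           = λ x y → V x ≡ V y × Iso (map x) (map y)
  ; isEquivalence = record
    { refl  = refl , Iso-refl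
    ; sym   = λ (p , i) → sym p , Iso-sym i
    ; trans = λ (p , i) (q , j) → trans p q , Iso-trans i j
    }
  }
  where open LabelledTreeRootedMap

{-# OPTIONS --safe #-}

-- Walking around the spanning tree, from the first half-edge at the root,
-- visits all 2n half-edges: at a tree half-edge cross the edge, then turn to
-- the next half-edge in the rotation. Orient the tree towards the vertex s + 1,
-- wherever the root is, and record for each half-edge visited whether it
-- belongs to a non-tree edge (and which half-edge is its mate), leads from the
-- vertex c towards s + 1 ("up c") or leads away from s + 1 ("down"). The map can
-- be recovered: read cyclically from right to left, "up" half-edges open
-- and "down" half-edges close parentheses, and the parentheses open at a given
-- time form the path from the current vertex to s + 1. Any cyclic word with as
-- many "up" as "down" letters arises, because the unmatched parentheses of a
-- linear reading match cyclically.
--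
-- On the side of the boards, the boundary path of the board has n row and n
-- column steps. A rook in an extra column joins a row step to an earlier column
-- step, and these pairs are the non-tree edges; the row of a rook in column c,
-- for c among the first s columns, is "up c"; the empty extra columns are the
-- "down" letters.

module Submission where

open import Defs
open import Data.Bool.Base using (Bool; true; false; not)
open import Data.Empty using (⊥)
open import Data.Fin.Base as Fin using (Fin; zero; suc; toℕ; fromℕ; fromℕ<; inject₁; punchOut; _↑ˡ_; _↑ʳ_)
import Data.Fin.Properties as Fin
open import Data.Fin.Induction using (<-weakInduction; >-weakInduction)
open import Data.Fin.Permutation as Perm using (Permutation′; _⟨$⟩ʳ_; _⟨$⟩ˡ_; _∘ₚ_)
open import Data.Fin.Relation.Unary.Top using (View; view; ‵fromℕ; ‵inj₁; ‵inject₁; view-fromℕ; view-inject₁)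
open import Data.Fin.Subset as Sub using (Subset; Side; inside; outside; _∈_; _∉_; _∪_; ⁅_⁆; ⊤; ∣_∣)
import Data.Fin.Subset.Properties as Sub
open import Data.List.Base using (List; []; _∷_; _++_; length; drop)
import Data.List.Base as List
import Data.List.Properties as List
import Data.List.Membership.Propositional as Mem
open import Data.List.Membership.Propositional.Properties using (∈-lookup)
open import Data.List.Relation.Unary.All as All using (All; []; _∷_)
import Data.List.Relation.Unary.All.Properties as All
import Data.List.Relation.Unary.Any as Any
open import Data.List.Relation.Unary.Any.Properties using (lookup-index)
open import Data.Maybe.Base as Maybe using (Maybe; just; nothing)
open import Data.Maybe.Properties using (just-injective; map-id; map-∘)
open import Data.Nat.Base using (ℕ; zero; suc; pred; _+_; _*_; _∸_; _≤_; _<_; z≤n; s≤s; >-nonZero)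
open import Data.Nat.DivMod using (_%_; _/_; m≡m%n+[m/n]*n; m%n<n)
open import Data.Nat.GeneralisedArithmetic using (iterate)
import Data.Nat.Properties as ℕ
open import Algebra.Properties.CommutativeMonoid.Sum ℕ.+-0-commutativeMonoid using (sum-cong-≗; ∑-distrib-+; sum-permute) renaming (sum to ∑)
open import Data.Product.Base using (Σ; ∃-syntax; _×_; _,_; proj₁; proj₂)
open import Data.Sum.Base as Sum⊎ using (_⊎_; inj₁; inj₂)
open import Data.Sum.Properties using (inj₁-injective; inj₂-injective; ≡-dec)
open import Data.Vec.Base as Vec using (Vec; []; _∷_; lookup; tabulate; take; _∷ʳ_)
import Data.Vec.Properties as Vec
open import Data.Unit.Base using (tt) renaming (⊤ to Unit)
open import Function.Base using (_∘_; id; case_of_)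
open import Function.Bundles using (Bijection)
open import Function.Definitions using (Injective)
open import Relation.Binary.Bundles using (Setoid)
open import Relation.Binary.Construct.Closure.ReflexiveTransitive using (Star; ε; _◅_; _◅◅_)
open import Relation.Binary.Definitions using (tri<; tri≈; tri>)
open import Relation.Binary.PropositionalEquality
open import Relation.Nullary using (¬_; Dec; yes; no; contradiction)
open import Relation.Nullary.Decidable using (does; dec-true; dec-false)

-- The half-edges of a map are numbered arbitrarily, so a word can only be matched with maps up to
-- isomorphism, and no inverse function is built. Instead `Realizes` says that a word is what the
-- tour of a given map reads. Every map realizes some word, isomorphic maps realize the same word,
-- the map built from a word realizes that word, and any map realizing it is isomorphic to the one
-- built. The last point rests on a rigidity fact: among families of stacks that obey the local
-- push, pop and skip rules around a cycle and are empty somewhere, there is only one. Hence the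
-- tree paths to s + 1 in a given map must be the stacks computed from its word. Orienting the tree
-- towards s + 1 rather than towards the root gives every label of V exactly one "up" letter; the
-- root merely cuts the cyclic word open. A non-tree edge contributes one row step and one column
-- step, so having equally many of both is the same condition as having as many "up" as "down"
-- letters. This is why there are exactly n extra columns.

-- Orbits of injections on finite sets, and the cyclic shift.

module _ {A : Set} (f : A → A) where

  iterate-suc : ∀ x m → iterate f x (suc m) ≡ f (iterate f x m)
  iterate-suc x zero    = refl
  iterate-suc x (suc m) = iterate-suc (f x) m

  iterate-+ : ∀ x a b → iterate f x (a + b) ≡ iterate f (iterate f x a) b
  iterate-+ x zero    b = refl
  iterate-+ x (suc a) b = iterate-+ (f x) a b

  iterate-period : ∀ x p q → iterate f x p ≡ x → iterate f x (q * p) ≡ x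
  iterate-period x p zero    eq = refl
  iterate-period x p (suc q) eq = begin
    iterate f x (p + q * p)           ≡⟨ iterate-+ x p (q * p) ⟩
    iterate f (iterate f x p) (q * p) ≡⟨ cong (λ y → iterate f y (q * p)) eq ⟩
    iterate f x (q * p)               ≡⟨ iterate-period x p q eq ⟩
    x                                 ∎
    where open ≡-Reasoning

  iterate-injective : Injective _≡_ _≡_ f → ∀ a {x y} → iterate f x a ≡ iterate f y a → x ≡ y
  iterate-injective inj zero    eq = eq
  iterate-injective inj (suc a) eq = inj (iterate-injective inj a eq)

  iterate-cancel : Injective _≡_ _≡_ f → ∀ {x y a b} → a ≤ b →
                   iterate f x a ≡ iterate f y b → x ≡ iterate f y (b ∸ a)
  iterate-cancel inj {x} {y} {a} {b} a≤b eq = iterate-injective inj a (begin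
    iterate f x a                       ≡⟨ eq ⟩
    iterate f y b                       ≡⟨ cong (iterate f y) (ℕ.m∸n+n≡m a≤b) ⟨
    iterate f y (b ∸ a + a)             ≡⟨ iterate-+ y (b ∸ a) a ⟩
    iterate f (iterate f y (b ∸ a)) a   ∎)
    where open ≡-Reasoning

  Reaches : A → A → Set
  Reaches x y = ∃[ m ] iterate f x m ≡ y

  reaches-trans : ∀ {x y z} → Reaches x y → Reaches y z → Reaches x z
  reaches-trans {x} (a , p) (b , q) =
    a + b , trans (iterate-+ x a b) (trans (cong (λ y → iterate f y b) p) q)

iterate-conj : {A B : Set} {f : A → A} {g : B → B} (h : A → B) → (∀ x → h (f x) ≡ g (h x)) →
               ∀ x m → h (iterate f x m) ≡ iterate g (h x) m
iterate-conj h eq x zero    = refl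
iterate-conj {f = f} {g} h eq x (suc m) =
  trans (iterate-conj h eq (f x) m) (cong (λ y → iterate g y m) (eq x))

-- A missed value could be punched out of the codomain, leaving an injection into a smaller set.
injective⇒surjective : ∀ {m} (f : Fin m → Fin m) → Injective _≡_ _≡_ f → ∀ y → ∃[ x ] f x ≡ y
injective⇒surjective {suc m} f inj y with Fin.any? (λ x → f x Fin.≟ y)
... | yes p = p
... | no ¬p = contradiction
  (Fin.injective⇒≤ {f = λ x → punchOut (λ eq → ¬p (x , sym eq))}
    (λ {x} {x′} eq → inj (Fin.punchOut-injective (λ e → ¬p (x , sym e)) (λ e → ¬p (x′ , sym e)) eq)))
  (ℕ.<⇒≱ (ℕ.n<1+n m))

injective⇒permutation : ∀ {m} (f : Fin m → Fin m) → Injective _≡_ _≡_ f → Permutation′ m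
injective⇒permutation f inj = Perm.permutation f g fg (λ x → inj (fg (f x)))
  where
  g = λ y → proj₁ (injective⇒surjective f inj y)
  fg = λ y → proj₂ (injective⇒surjective f inj y)

Transitive : ∀ {m} → (Fin m → Fin m) → Set
Transitive f = ∀ x y → Reaches f x y

module _ {m} (f : Fin m → Fin m) (inj : Injective _≡_ _≡_ f) where

  -- Two of the first m + 1 iterates coincide, and injectivity cancels their common initial part.
  returns : ∀ x → ∃[ p ] iterate f x (suc p) ≡ x
  returns x with Fin.pigeonhole (ℕ.n<1+n m) (λ i → iterate f x (toℕ i))
  ... | i , j , i<j , eq = pred (toℕ j ∸ toℕ i) ,
    trans (cong (iterate f x) (ℕ.suc-pred _ {{>-nonZero (ℕ.m<n⇒0<n∸m i<j)}}))
          (sym (iterate-cancel f inj (ℕ.<⇒≤ i<j) eq))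

  -- Going back a steps amounts to completing a rounds of length `suc p`, of which a steps are
  -- already done.
  reaches-sym : ∀ {x y} → Reaches f x y → Reaches f y x
  reaches-sym {x} (a , refl) with p , eq ← returns x = a * p , (begin
    iterate f (iterate f x a) (a * p) ≡⟨ iterate-+ f x a (a * p) ⟨
    iterate f x (a + a * p)           ≡⟨ cong (iterate f x) (ℕ.*-suc a p) ⟨
    iterate f x (a * suc p)           ≡⟨ iterate-period f x (suc p) a eq ⟩
    x                                 ∎)
    where open ≡-Reasoning

  -- The residue modulo a period p determines the point reached from x.
  period-≥ : Transitive f → ∀ x p → iterate f x (suc p) ≡ x → m ≤ suc p
  period-≥ tr x p eq = Fin.injective⇒≤ {f = g} λ {y} {z} gy≡gz → begin
    y                                        ≡⟨ reduce y ⟨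
    iterate f x (time y % suc p)             ≡⟨ cong (iterate f x) (Fin.fromℕ<-injective _ _ _ _ gy≡gz) ⟩
    iterate f x (time z % suc p)             ≡⟨ reduce z ⟩
    z                                        ∎
    where
    open ≡-Reasoning
    time = λ y → proj₁ (tr x y)
    g : Fin m → Fin (suc p)
    g y = fromℕ< (m%n<n (time y) (suc p))
    reduce : ∀ y → iterate f x (time y % suc p) ≡ y
    reduce y = begin
      iterate f x (time y % suc p)
        ≡⟨ cong (λ z → iterate f z (time y % suc p)) (iterate-period f x (suc p) (time y / suc p) eq) ⟨
      iterate f (iterate f x (time y / suc p * suc p)) (time y % suc p)
        ≡⟨ iterate-+ f x (time y / suc p * suc p) _ ⟨
      iterate f x (time y / suc p * suc p + time y % suc p)
        ≡⟨ cong (iterate f x) (trans (ℕ.+-comm (time y / suc p * suc p) _) (sym (m≡m%n+[m/n]*n (time y) (suc p)))) ⟩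
      iterate f x (time y)
        ≡⟨ proj₂ (tr x y) ⟩
      y ∎

  private
    orbit-distinct : Transitive f → ∀ x {i j : Fin m} → toℕ i < toℕ j →
                     iterate f x (toℕ i) ≢ iterate f x (toℕ j)
    orbit-distinct tr x {i} {j} i<j eq =
      ℕ.<⇒≱ (ℕ.≤-<-trans (ℕ.m∸n≤m (toℕ j) (toℕ i)) (Fin.toℕ<n j))
        (subst (m ≤_) suc-pred (period-≥ tr x _
          (trans (cong (iterate f x) suc-pred) (sym (iterate-cancel f inj (ℕ.<⇒≤ i<j) eq)))))
      where suc-pred = ℕ.suc-pred _ {{>-nonZero (ℕ.m<n⇒0<n∸m i<j)}}

  orbit-injective : Transitive f → ∀ x → Injective _≡_ _≡_ (λ (i : Fin m) → iterate f x (toℕ i))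
  orbit-injective tr x {i} {j} eq with ℕ.<-cmp (toℕ i) (toℕ j)
  ... | tri< i<j _ _ = contradiction eq (orbit-distinct tr x i<j)
  ... | tri≈ _ i≡j _ = Fin.toℕ-injective i≡j
  ... | tri> _ _ j<i = contradiction (sym eq) (orbit-distinct tr x j<i)

shiftʳ : ∀ {m} → Fin m → Fin m
shiftʳ {suc m} i with view i
... | ‵fromℕ     = zero
... | ‵inject₁ j = suc j

shiftˡ : ∀ {m} → Fin m → Fin m
shiftˡ zero    = fromℕ _
shiftˡ (suc i) = inject₁ i

shift : ∀ {m} → Permutation′ m
shift {m} = Perm.permutation shiftʳ shiftˡ right left
  where
  right : ∀ {m} (i : Fin m) → shiftʳ (shiftˡ i) ≡ i
  right {suc m} zero rewrite view-fromℕ m = refl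
  right (suc i) rewrite view-inject₁ i = refl
  left : ∀ {m} (i : Fin m) → shiftˡ (shiftʳ i) ≡ i
  left {suc m} i with view i
  ... | ‵fromℕ     = refl
  ... | ‵inject₁ j = refl

shiftʳ-inject₁ : ∀ {m} (i : Fin m) → shiftʳ (inject₁ i) ≡ suc i
shiftʳ-inject₁ i = Perm.inverseʳ shift {suc i}

shiftʳ-fromℕ : ∀ m → shiftʳ (fromℕ m) ≡ zero
shiftʳ-fromℕ m = Perm.inverseʳ (shift {suc m}) {zero}

shift-iterate : ∀ {m} (i : Fin (suc m)) → iterate shiftʳ zero (toℕ i) ≡ i
shift-iterate i = go (toℕ i) i refl
  where
  go : ∀ {m} a (i : Fin (suc m)) → toℕ i ≡ a → iterate shiftʳ zero a ≡ i
  go zero    zero    eq = refl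
  go (suc a) (suc i) eq = trans (iterate-suc shiftʳ zero a)
    (trans (cong shiftʳ (go a (inject₁ i) (trans (Fin.toℕ-inject₁ i) (ℕ.suc-injective eq)))) (shiftʳ-inject₁ i))

permutation-injective : ∀ {m} (π : Permutation′ m) → Injective _≡_ _≡_ (π ⟨$⟩ʳ_)
permutation-injective π eq = trans (sym (Perm.inverseˡ π)) (trans (cong (π ⟨$⟩ˡ_) eq) (Perm.inverseˡ π))

shift-injective : ∀ {m} → Injective _≡_ _≡_ (shiftʳ {m})
shift-injective = permutation-injective shift

shift-transitive : ∀ {m} → Transitive (shiftʳ {m})
shift-transitive {suc m} x y = reaches-trans shiftʳ
  (reaches-sym shiftʳ shift-injective (toℕ x , shift-iterate x)) (toℕ y , shift-iterate y)

-- After m steps the orbit of x closes up, since it has m distinct points.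
orbit-shift : ∀ {m} (f : Fin m → Fin m) → Injective _≡_ _≡_ f → Transitive f →
              ∀ x (i : Fin m) → iterate f x (toℕ (shiftʳ i)) ≡ f (iterate f x (toℕ i))
orbit-shift {suc m} f inj tr x i = go (view i)
  where
  closes : iterate f x (suc m) ≡ x
  closes with injective⇒surjective _ (orbit-injective f inj tr x) (iterate f x (suc m))
  ... | zero  , eq = sym eq
  ... | suc j , eq = contradiction
    (period-≥ f inj tr x (m ∸ suc (toℕ j)) (trans (cong (iterate f x) (sym m∸j)) (sym (iterate-cancel f inj j<m eq))))
    (ℕ.<⇒≱ (subst (_< suc m) m∸j (s≤s (ℕ.m∸n≤m m (toℕ j)))))
    where
    j<m : suc (toℕ j) ≤ suc m
    j<m = ℕ.<⇒≤ (s≤s (Fin.toℕ<n j))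
    m∸j : m ∸ toℕ j ≡ suc (m ∸ suc (toℕ j))
    m∸j = sym (trans (sym (ℕ.+-∸-assoc 1 (Fin.toℕ<n j))) refl)
  go : ∀ {i : Fin (suc m)} → View i → iterate f x (toℕ (shiftʳ i)) ≡ f (iterate f x (toℕ i))
  go (‵inj₁ {i = j} _) = begin
    iterate f x (toℕ (shiftʳ (inject₁ j))) ≡⟨ cong (λ k → iterate f x (toℕ k)) (shiftʳ-inject₁ j) ⟩
    iterate f x (suc (toℕ j))              ≡⟨ iterate-suc f x (toℕ j) ⟩
    f (iterate f x (toℕ j))                ≡⟨ cong (λ a → f (iterate f x a)) (Fin.toℕ-inject₁ j) ⟨
    f (iterate f x (toℕ (inject₁ j)))      ∎
    where open ≡-Reasoning
  go ‵fromℕ = begin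
    iterate f x (toℕ (shiftʳ (fromℕ m)))   ≡⟨ cong (λ k → iterate f x (toℕ k)) (shiftʳ-fromℕ m) ⟩
    x                                      ≡⟨ closes ⟨
    iterate f x (suc m)                    ≡⟨ iterate-suc f x m ⟩
    f (iterate f x m)                      ≡⟨ cong (λ a → f (iterate f x a)) (Fin.toℕ-fromℕ m) ⟨
    f (iterate f x (toℕ (fromℕ m)))        ∎
    where open ≡-Reasoning

-- Stacks along linear and cyclic words.

data Step (A : Set) : Set where
  push : A → Step A
  pop  : Step A
  skip : Step A

module _ {A : Set} where

  act : Step A → List A → List A
  act (push a) S = a ∷ S
  act pop      S = drop 1 S
  act skip     S = S

  -- Words are read from right to left: entry i is the stack before letter i,
  -- so that the last entry is the initial stack X.
  stacks : ∀ {m} → (Fin m → Step A) → List A → Fin (suc m) → List A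
  stacks {suc m} w X (suc i) = stacks (w ∘ suc) X i
  stacks {zero}  w X zero    = X
  stacks {suc m} w X zero    = act (w zero) (stacks (w ∘ suc) X zero)

  stacks-step : ∀ {m} (w : Fin m → Step A) X i → stacks w X (inject₁ i) ≡ act (w i) (stacks w X (suc i))
  stacks-step {suc m} w X zero    = refl
  stacks-step {suc m} w X (suc i) = stacks-step (w ∘ suc) X i

  stacks-last : ∀ {m} (w : Fin m → Step A) X → stacks w X (fromℕ m) ≡ X
  stacks-last {zero}  w X = refl
  stacks-last {suc m} w X = stacks-last (w ∘ suc) X

  isPush isPop : Step A → ℕ
  isPush (push _) = 1
  isPush _        = 0
  isPop pop = 1
  isPop _   = 0

  -- The number of unmatched closing parentheses of the linear reading.
  underflow : ∀ {m} → (Fin m → Step A) → ℕ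
  underflow-step : Step A → List A → ℕ
  underflow-step pop [] = 1
  underflow-step _   _  = 0
  underflow {zero}  w = 0
  underflow {suc m} w = underflow-step (w zero) (stacks (w ∘ suc) [] zero) + underflow (w ∘ suc)

  drop-drop : ∀ k (X : List A) → drop 1 (drop k X) ≡ drop (suc k) X
  drop-drop k X = trans (List.drop-drop k 1 X) (cong (λ j → drop j X) (ℕ.+-comm k 1))

  -- Only the unmatched pops reach down to X, and the unmatched pushes stay above what they leave of
  -- it.
  stacks-zero : ∀ {m} (w : Fin m → Step A) X →
                stacks w X zero ≡ stacks w [] zero ++ drop (underflow w) X
  stacks-zero {zero}  w X = refl
  stacks-zero {suc m} w X with w zero | stacks-zero (w ∘ suc) X
  ... | push a | ih = cong (a ∷_) ih
  ... | skip   | ih = ih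
  ... | pop    | ih with stacks (w ∘ suc) [] zero
  ...   | []    = trans (cong (drop 1) ih) (drop-drop (underflow (w ∘ suc)) X)
  ...   | _ ∷ _ = cong (drop 1) ih

  -- Every pop either removes a pushed entry or is counted by `underflow`.
  stacks-length : ∀ {m} (w : Fin m → Step A) →
                  length (stacks w [] zero) + ∑ (isPop ∘ w) ≡ ∑ (isPush ∘ w) + underflow w
  stacks-length {zero}  w = refl
  stacks-length {suc m} w with w zero | stacks-length (w ∘ suc)
  ... | push a | ih = cong suc ih
  ... | skip   | ih = ih
  ... | pop    | ih with stacks (w ∘ suc) [] zero
  ...   | []    = trans (cong suc ih) (sym (ℕ.+-suc _ _))
  ...   | _ ∷ S = trans (ℕ.+-suc (length S) _) ih

  underflow-≥ : ∀ {m} (w : Fin (suc m) → Step A) → underflow (w ∘ suc) ≤ underflow w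
  underflow-≥ w = ℕ.m≤n+m _ _

  -- X holds an entry for each pop that would underflow from the empty stack, so no pop meets an
  -- empty stack.
  stacks-pop : ∀ {m} (w : Fin m → Step A) X → underflow w ≤ length X →
               ∀ i → w i ≡ pop → ∃[ a ] stacks w X (suc i) ≡ a ∷ stacks w X (inject₁ i)
  stacks-pop {suc m} w X le (suc i) eq = stacks-pop (w ∘ suc) X (ℕ.≤-trans (underflow-≥ w) le) i eq
  stacks-pop {suc m} w X le zero eq rewrite eq | stacks-zero (w ∘ suc) X with stacks (w ∘ suc) [] zero
  ... | a ∷ S = a , refl
  ... | [] with drop (underflow (w ∘ suc)) X in eq′
  ...   | a ∷ S = a , refl
  ...   | [] = contradiction
    (trans (sym (List.length-drop (underflow (w ∘ suc)) X)) (cong length eq′))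
    (ℕ.m>n⇒m∸n≢0 le)

  -- The last unmatched pop to be read finds nothing above X and removes the last entry of X.
  -- Without unmatched pops, X is empty itself.
  stacks-empty : ∀ {m} (w : Fin m → Step A) X → length X ≡ underflow w →
                 ∃[ i ] stacks w X i ≡ []
  stacks-empty {zero}  w [] eq = zero , refl
  stacks-empty {suc m} w X eq
    with w zero in e₀ | stacks (w ∘ suc) [] zero in eS
  ... | push a | _     = let i , p = stacks-empty (w ∘ suc) X eq in suc i , p
  ... | skip   | _     = let i , p = stacks-empty (w ∘ suc) X eq in suc i , p
  ... | pop    | _ ∷ _ = let i , p = stacks-empty (w ∘ suc) X eq in suc i , p
  ... | pop    | []    = zero , (begin
    act (w zero) (stacks (w ∘ suc) X zero) ≡⟨ cong₂ act e₀ (stacks-zero (w ∘ suc) X) ⟩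
    drop 1 (stacks (w ∘ suc) [] zero ++ drop u X) ≡⟨ cong (λ S → drop 1 (S ++ drop u X)) eS ⟩
    drop 1 (drop u X) ≡⟨ drop-drop u X ⟩
    drop (suc u) X ≡⟨ cong (λ k → drop k X) eq ⟨
    drop (length X) X ≡⟨ List.drop-all (length X) X ℕ.≤-refl ⟩
    [] ∎)
    where
    open ≡-Reasoning
    u = underflow (w ∘ suc)

  -- Local rules around the cycle together with an empty stack somewhere; `stacks-unique` shows that
  -- they leave no freedom. The argument of `bottom` excludes m = 0, where there is no position to
  -- return.
  record Stacks {m} (w : Fin m → Step A) : Set where
    field
      stack      : Fin m → List A
      stack-push : ∀ {i a} → w i ≡ push a → stack i ≡ a ∷ stack (shiftʳ i)
      stack-pop  : ∀ {i} → w i ≡ pop → ∃[ a ] stack (shiftʳ i) ≡ a ∷ stack i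
      stack-skip : ∀ {i} → w i ≡ skip → stack i ≡ stack (shiftʳ i)
      bottom     : Fin m → ∃[ i ] stack i ≡ []

  -- The unmatched pushes form the initial stack; as many pops are unmatched.
  cyclicStacks : ∀ {m} (w : Fin m → Step A) → ∑ (isPush ∘ w) ≡ ∑ (isPop ∘ w) → Stacks w
  cyclicStacks {zero} w balanced = record
    { stack = λ () ; stack-push = λ {} ; stack-pop = λ {} ; stack-skip = λ {} ; bottom = λ () }
  cyclicStacks {suc m} w balanced = record
    { stack = st
    ; stack-push = λ {i} eq → trans (stacks-step w X i) (trans (cong (λ a → act a (stacks w X (suc i))) eq) (cong (_ ∷_) (next i)))
    ; stack-pop = λ {i} eq → let a , p = stacks-pop w X (ℕ.≤-reflexive (sym length-X)) i eq in a , trans (sym (next i)) p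
    ; stack-skip = λ {i} eq → trans (stacks-step w X i) (trans (cong (λ a → act a (stacks w X (suc i))) eq) (next i))
    ; bottom = λ _ → bot
    }
    where
    X = stacks w [] zero
    st = λ i → stacks w X (inject₁ i)

    length-X : length X ≡ underflow w
    length-X = ℕ.+-cancelʳ-≡ (∑ (isPop ∘ w)) _ _ (trans (stacks-length w)
      (trans (ℕ.+-comm _ (underflow w)) (cong (underflow w +_) balanced)))

    closed : stacks w X zero ≡ X
    closed = trans (stacks-zero w X) (trans
      (cong (X ++_) (List.drop-all (underflow w) X (ℕ.≤-reflexive length-X))) (List.++-identityʳ X))

    next : ∀ i → stacks w X (suc i) ≡ st (shiftʳ i)
    next i = go (view i)
      where
      go : ∀ {i} → View i → stacks w X (suc i) ≡ st (shiftʳ i)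
      go ‵fromℕ = trans (stacks-last w X) (trans (sym closed) (cong st (sym (shiftʳ-fromℕ m))))
      go (‵inj₁ {i = j} _) = cong st (sym (shiftʳ-inject₁ j))

    bot : ∃[ i ] st i ≡ []
    bot with stacks-empty w X length-X
    ... | i , eq = go (view i) eq
      where
      go : ∀ {i} → View i → stacks w X i ≡ [] → ∃[ i ] st i ≡ []
      go ‵fromℕ eq = zero , trans closed (trans (sym (stacks-last w X)) eq)
      go (‵inj₁ {i = j} _) eq = j , eq

-- Codes and their cyclic parenthesis structure.

∑-cong : ∀ {m} {f g : Fin m → ℕ} → (∀ i → f i ≡ g i) → ∑ f ≡ ∑ g
∑-cong = sum-cong-≗

data Letter (m s : ℕ) : Set where
  chord : Fin m → Letter m s
  up    : Fin s → Letter m s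
  down  : Letter m s

isUp isDown : ∀ {m s} → Letter m s → ℕ
isUp (up _) = 1
isUp _      = 0
isDown down = 1
isDown _    = 0

-- The half-edges of a tree-rooted map in the order of the tour of the tree,
-- cyclically: the two sides of a non-tree edge point to each other, and the two
-- sides of a tree edge are up c, at its endpoint c farther from s + 1, and down.
record IsCode {m s : ℕ} (letter : Fin m → Letter m s) : Set where
  field
    chord-sym    : ∀ {i j} → letter i ≡ chord j → letter j ≡ chord i
    chord-irrefl : ∀ {i} → letter i ≢ chord i
    up-injective : ∀ {i j c} → letter i ≡ up c → letter j ≡ up c → i ≡ j
    balanced     : ∑ (isUp ∘ letter) ≡ ∑ (isDown ∘ letter)

-- The position is pushed rather than the label c, so that a stack is a list of half-edges, namely a
-- path in the tree.
step : ∀ {m s} → (Fin m → Letter m s) → Fin m → Step (Fin m)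
step letter i with letter i
... | chord _ = skip
... | up _    = push i
... | down    = pop

module _ {m s} (letter : Fin m → Letter m s) {i : Fin m} where

  step-chord : ∀ {j} → letter i ≡ chord j → step letter i ≡ skip
  step-chord eq with letter i
  step-chord refl | chord _ = refl

  step-up : ∀ {c} → letter i ≡ up c → step letter i ≡ push i
  step-up eq with letter i
  step-up refl | up _ = refl

  step-down : letter i ≡ down → step letter i ≡ pop
  step-down eq with letter i
  step-down refl | down = refl

  isPush-step : isPush (step letter i) ≡ isUp (letter i)
  isPush-step with letter i
  ... | chord _ = refl
  ... | up _    = refl
  ... | down    = refl

  isPop-step : isPop (step letter i) ≡ isDown (letter i)
  isPop-step with letter i
  ... | chord _ = refl
  ... | up _    = refl
  ... | down    = refl

++-∷-acyclic : ∀ {A : Set} (P : List A) {a X} → X ≢ P ++ a ∷ X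
++-∷-acyclic P {a} {X} eq = ℕ.m≢1+n+m (length X) {length P} (begin
  length X                 ≡⟨ cong length eq ⟩
  length (P ++ a ∷ X)      ≡⟨ List.length-++ P ⟩
  length P + suc (length X) ≡⟨ ℕ.+-suc (length P) (length X) ⟩
  suc (length P + length X) ∎)
  where open ≡-Reasoning

-- A vertex is named by the first edge of its path to s + 1, and the empty path belongs to s + 1
-- itself.
vertex : ∀ {m s} → (Fin m → Letter m s) → List (Fin m) → Fin (suc s)
vertex {s = s} letter [] = fromℕ s
vertex {s = s} letter (j ∷ _) with letter j
... | up c = inject₁ c
... | _    = fromℕ s

module Contour {m s} {letter : Fin m → Letter m s} (isCode : IsCode letter) where

  open IsCode isCode

  private
    σ : Fin m → Fin m
    σ = shiftʳ

  contourStacks : Stacks (step letter)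
  contourStacks = cyclicStacks (step letter)
    (trans (∑-cong (λ i → isPush-step letter {i})) (trans balanced (sym (∑-cong (λ i → isPop-step letter {i})))))

  open Stacks contourStacks public

  stack-chord : ∀ {i j} → letter i ≡ chord j → stack i ≡ stack (σ i)
  stack-chord eq = stack-skip (step-chord letter eq)

  stack-up : ∀ {i c} → letter i ≡ up c → stack i ≡ i ∷ stack (σ i)
  stack-up eq = stack-push (step-up letter eq)

  stack-down : ∀ {i} → letter i ≡ down → ∃[ j ] stack (σ i) ≡ j ∷ stack i
  stack-down eq = stack-pop (step-down letter eq)

  IsUp : Fin m → Set
  IsUp i = ∃[ c ] letter i ≡ up c

  -- In the tree: the path from the vertex at i to s + 1 passes through the edge j and continues
  -- with X.
  Over : Fin m → List (Fin m) → Fin m → Set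
  Over j X i = ∃[ P ] stack i ≡ P ++ j ∷ X

  over-right : ∀ {j X i} → Over j X i → (i ≡ j × IsUp j × stack j ≡ j ∷ X) ⊎ Over j X (σ i)
  over-right {j} {X} {i} (P , eq) with letter i in e
  ... | chord _ = inj₂ (P , trans (sym (stack-chord e)) eq)
  ... | down with a , p ← stack-down e = inj₂ (a ∷ P , trans p (cong (a ∷_) eq))
  ... | up c with P | trans (sym (stack-up e)) eq
  ...   | []     | p = case List.∷-injective p of λ where
                         (refl , refl) → inj₁ (refl , (c , e) , stack-up e)
  ...   | _ ∷ P′ | p = inj₂ (P′ , List.∷-injectiveʳ p)

  over-left : ∀ {j X i} → Over j X (σ i) → (letter i ≡ down × stack (σ i) ≡ j ∷ stack i) ⊎ Over j X i
  over-left {j} {X} {i} (P , eq) with letter i in e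
  ... | chord _ = inj₂ (P , trans (stack-chord e) eq)
  ... | up c = inj₂ (i ∷ P , trans (stack-up e) (cong (i ∷_) eq))
  ... | down with a , p ← stack-down e with P | trans (sym p) eq
  ...   | []     | q = case List.∷-injectiveˡ q of λ where refl → inj₁ (refl , p)
  ...   | _ ∷ P′ | q = inj₂ (P′ , List.∷-injectiveʳ q)

  On : Fin m → Fin m → Set
  On j i = ∃[ X ] Over j X i

  off-bottom : ∀ {j X i} → stack i ≡ [] → ¬ Over j X i
  off-bottom eq ([]    , p) = case trans (sym eq) p of λ ()
  off-bottom eq (_ ∷ _ , p) = case trans (sym eq) p of λ ()

  -- Going right from i to a position with empty stack, the part j ∷ X must disappear, which by
  -- `over-right` happens only at j.
  over⇒stack : ∀ {j X i} → Over j X i → IsUp j × stack j ≡ j ∷ X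
  over⇒stack {j} {X} {i} o with b , eq ← bottom i with a , p ← shift-transitive i b = go a i o p
    where
    go : ∀ a i → Over j X i → iterate σ i a ≡ b → IsUp j × stack j ≡ j ∷ X
    go zero    i o refl = contradiction o (off-bottom eq)
    go (suc a) i o p with over-right o
    ... | inj₁ (_ , q) = q
    ... | inj₂ o′      = go a (σ i) o′ p

  top⇒stack : ∀ {j X i} → stack i ≡ j ∷ X → stack j ≡ j ∷ X
  top⇒stack eq = proj₂ (over⇒stack ([] , eq))

  top⇒up : ∀ {j X i} → stack i ≡ j ∷ X → IsUp j
  top⇒up eq = proj₁ (over⇒stack ([] , eq))

  -- What lies under j is the same wherever j is on the stack, so a further j would make `stack i′`
  -- a proper suffix of itself.
  top⇒off : ∀ {j i i′} → stack i ≡ j ∷ stack i′ → ¬ On j i′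
  top⇒off {j} {i} {i′} eq (Y , P , p) = ++-∷-acyclic P
    (trans p (cong (λ Z → P ++ j ∷ Z) (List.∷-injectiveʳ
      (trans (sym (proj₂ (over⇒stack (P , p)))) (top⇒stack eq)))))

  exit : ∀ {j} a {i} → On j i → ¬ On j (iterate σ i a) →
         ∃[ b ] b < a × iterate σ i b ≡ j × (∀ c → c ≤ b → On j (iterate σ i c))
  exit zero    o off = contradiction o off
  exit (suc a) {i} (X , o) off with over-right o
  ... | inj₁ (i≡j , _) = zero , s≤s z≤n , i≡j , λ where zero z≤n → X , o
  ... | inj₂ o′ with b , b<a , p , on ← exit a (X , o′) off =
    suc b , s≤s b<a , p , λ where
      zero    _        → X , o
      (suc c) (s≤s le) → on c le

  Pops : Fin m → Fin m → Set
  Pops i j = letter i ≡ down × stack (σ i) ≡ j ∷ stack i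

  enter : ∀ {j} a {i} → ¬ On j i → On j (iterate σ i a) → ∃[ b ] b < a × Pops (iterate σ i b) j
  enter zero    off o = contradiction o off
  enter (suc a) {i} off (X , o) with over-left (subst (Over _ X) (iterate-suc σ i a) o)
  ... | inj₁ pops = a , ℕ.n<1+n a , pops
  ... | inj₂ o′ with b , b<a , pops ← enter a off (X , o′) = b , ℕ.m<n⇒m<1+n b<a , pops

  popper : ∀ {j} → IsUp j → ∃[ i ] Pops i j
  popper {j} (c , eq) with i , q ← bottom j with a , refl ← shift-transitive i j
    with b , _ , pops ← enter a (λ (X , o) → off-bottom q o) (_ , [] , stack-up eq) =
    _ , pops

  pops-exit : ∀ {i j} → Pops i j →
              ∃[ b ] iterate σ (σ i) b ≡ j × (∀ c → c ≤ b → On j (iterate σ (σ i) c))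
  pops-exit {i} {j} (_ , eq) with a , q ← shift-transitive (σ i) i
    with b , _ , r ← exit a (_ , [] , eq) (subst (¬_ ∘ On j) (sym q) (top⇒off eq)) = b , r

  -- Each pop is followed by a stretch that ends at j and has j on the stack throughout. If one
  -- stretch were longer, it would contain the position of the other pop, where j is off the stack.
  pops-unique : ∀ {j i i′} → Pops i j → Pops i′ j → i ≡ i′
  pops-unique {j} p p′ with pops-exit p | pops-exit p′
  ... | a , r , on | a′ , r′ , on′ = case ℕ.≤-total a a′ of λ where
      (inj₁ le) → earlier p le r r′ on′
      (inj₂ le) → sym (earlier p′ le r′ r on)
    where
    earlier : ∀ {i i′ a a′} → Pops i j → a ≤ a′ → iterate σ (σ i) a ≡ j → iterate σ (σ i′) a′ ≡ j →
              (∀ c → c ≤ a′ → On j (iterate σ (σ i′) c)) → i ≡ i′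
    earlier {i} {i′} {a} {a′} (_ , eq) le r r′ on
      with a′ ∸ a in d | iterate-cancel σ shift-injective le (trans r (sym r′))
    ... | zero   | q = shift-injective q
    ... | suc d′ | q = contradiction
      (subst (On j) (sym (shift-injective (trans q (iterate-suc σ (σ i′) d′))))
        (on d′ (ℕ.≤-trans (ℕ.n≤1+n d′) (ℕ.≤-trans (ℕ.≤-reflexive (sym d)) (ℕ.m∸n≤m a′ a)))))
      (top⇒off eq)

  -- A symmetric relation, so that `mate` is an involution once partners are unique. `below` means
  -- that the partner is at the end farther from s + 1, `above` that it is at the nearer end.
  data Mate (i j : Fin m) : Set where
    across : letter i ≡ chord j → Mate i j
    below  : Pops i j → Mate i j
    above  : Pops j i → Mate i j

  mate-sym : ∀ {i j} → Mate i j → Mate j i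
  mate-sym (across eq) = across (chord-sym eq)
  mate-sym (below p)   = above p
  mate-sym (above p)   = below p

  pops⇒up : ∀ {i j} → Pops i j → IsUp j
  pops⇒up (_ , eq) = top⇒up eq

  mate-unique : ∀ {i j j′} → Mate i j → Mate i j′ → j ≡ j′
  mate-unique (across p) (across q) = case trans (sym p) q of λ where refl → refl
  mate-unique (below (_ , p)) (below (_ , q)) = List.∷-injectiveˡ (trans (sym p) q)
  mate-unique (above p) (above q) = pops-unique p q
  mate-unique (across p) (below (q , _)) = case trans (sym p) q of λ ()
  mate-unique (below (q , _)) (across p) = case trans (sym p) q of λ ()
  mate-unique (across p) (above q) = case trans (sym p) (proj₂ (pops⇒up q)) of λ ()
  mate-unique (above q) (across p) = case trans (sym p) (proj₂ (pops⇒up q)) of λ ()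
  mate-unique (below (p , _)) (above q) = case trans (sym p) (proj₂ (pops⇒up q)) of λ ()
  mate-unique (above q) (below (p , _)) = case trans (sym p) (proj₂ (pops⇒up q)) of λ ()

  mate-exists : ∀ i → ∃[ j ] Mate i j
  mate-exists i with letter i in eq
  ... | chord j = j , across eq
  ... | up c with j , p ← popper (c , eq) = j , above p
  ... | down with j , p ← stack-down eq = j , below (eq , p)

  mate-irrefl : ∀ {i} → ¬ Mate i i
  mate-irrefl (across eq) = chord-irrefl eq
  mate-irrefl (below p)   = case trans (sym (proj₁ p)) (proj₂ (pops⇒up p)) of λ ()
  mate-irrefl (above p)   = case trans (sym (proj₁ p)) (proj₂ (pops⇒up p)) of λ ()

  mate : Fin m → Fin m
  mate i = proj₁ (mate-exists i)

  mate-spec : ∀ i → Mate i (mate i)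
  mate-spec i = proj₂ (mate-exists i)

  mate-mate : ∀ i → mate (mate i) ≡ i
  mate-mate i = mate-unique (mate-spec (mate i)) (mate-sym (mate-spec i))

  mate-distinct : ∀ i → mate i ≢ i
  mate-distinct i eq = mate-irrefl (subst (Mate i) eq (mate-spec i))

  data Turn (i : Fin m) : Fin m → Set where
    stay : ∀ {j} → letter i ≡ chord j → Turn i i
    below  : ∀ {j} → Pops i j → Turn i j
    above  : ∀ {j} → Pops j i → Turn i j

  turn-exists : ∀ i → ∃[ j ] Turn i j
  turn-exists i with mate-spec i
  ... | across p = i , stay p
  ... | below p  = mate i , below p
  ... | above p  = mate i , above p

  turn-unique : ∀ {i j j′} → Turn i j → Turn i j′ → j ≡ j′
  turn-unique (stay _)  (stay _)  = refl
  turn-unique (stay p)  (below q) = case trans (sym p) (proj₁ q) of λ ()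
  turn-unique (below q) (stay p)  = case trans (sym p) (proj₁ q) of λ ()
  turn-unique (stay p)  (above q) = case trans (sym p) (proj₂ (pops⇒up q)) of λ ()
  turn-unique (above q) (stay p)  = case trans (sym p) (proj₂ (pops⇒up q)) of λ ()
  turn-unique (below p) (below q) = mate-unique (below p) (below q)
  turn-unique (below p) (above q) = mate-unique (below p) (above q)
  turn-unique (above p) (below q) = mate-unique (above p) (below q)
  turn-unique (above p) (above q) = mate-unique (above p) (above q)

  turn-sym : ∀ {i j} → Turn i j → Turn j i
  turn-sym (stay p)  = stay p
  turn-sym (below p) = above p
  turn-sym (above p) = below p

  turn : Fin m → Fin m
  turn i = proj₁ (turn-exists i)

  turn-spec : ∀ i → Turn i (turn i)
  turn-spec i = proj₂ (turn-exists i)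

  turn-turn : ∀ i → turn (turn i) ≡ i
  turn-turn i = turn-unique (turn-spec (turn i)) (turn-sym (turn-spec i))

  -- The tour turns and then rotates, so the shift must equal `next` after `turn`. As `turn` is an
  -- involution, this can be solved for `next`.
  next : Permutation′ m
  next = Perm.permutation turn turn turn-turn turn-turn ∘ₚ shift

  stack-turn : ∀ {i j} → Turn i j → stack j ≡ stack (σ i)
  stack-turn (stay p)  = stack-chord p
  stack-turn (below (_ , p)) = trans (top⇒stack p) (sym p)
  stack-turn (above p@(_ , q)) = List.∷-injectiveʳ (trans (sym (top⇒stack q)) (stack-up (proj₂ (pops⇒up p))))

  stack-next : ∀ i → stack (next ⟨$⟩ʳ i) ≡ stack i
  stack-next i = trans (sym (stack-turn (turn-spec (turn i)))) (cong stack (turn-turn i))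

  turn⇒next : ∀ {i j} → Turn i j → next ⟨$⟩ʳ i ≡ σ j
  turn⇒next {i} t = cong σ (turn-unique (turn-spec i) t)

  -- Between i and i′ the tour makes excursions through the other endpoints of
  -- the edges at the current vertex; next skips one excursion at a time.
  next-full : ∀ {i i′} → stack i ≡ stack i′ → Reaches (next ⟨$⟩ʳ_) i i′
  next-full {i} {i′} eq with a , p ← shift-transitive i i′ = go (suc a) a (ℕ.n<1+n a) eq p
    where
    -- N bounds the number a of remaining steps, because a whole excursion is skipped at once and a
    -- does not decrease structurally.
    go : ∀ N a → a < N → ∀ {i i′} → stack i ≡ stack i′ → iterate σ i a ≡ i′ → Reaches (next ⟨$⟩ʳ_) i i′
    go (suc N) zero    _ eq p = zero , p
    go (suc N) (suc a) (s≤s a<N) {i} {i′} eq p = advance (turn-spec i)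
      where
      open ≡-Reasoning
      -- The excursion takes b steps from i to j and one more to `next` of i, which leaves a - b of
      -- the `suc a` steps.
      resume : ∀ {j b} → b ≤ a → Turn i j → iterate σ i b ≡ j → Reaches (next ⟨$⟩ʳ_) i i′
      resume {j} {b} b≤a t q with c , r ← go N (a ∸ b) (ℕ.≤-<-trans (ℕ.m∸n≤m a b) a<N)
          {σ j} {i′} (trans (cong stack (sym (turn⇒next t))) (trans (stack-next i) eq)) (begin
            iterate σ (σ j) (a ∸ b)               ≡⟨ cong (λ x → iterate σ (σ x) (a ∸ b)) q ⟨
            iterate σ (σ (iterate σ i b)) (a ∸ b) ≡⟨ cong (λ x → iterate σ x (a ∸ b)) (iterate-suc σ i b) ⟨
            iterate σ (iterate σ i (suc b)) (a ∸ b) ≡⟨ iterate-+ σ i (suc b) (a ∸ b) ⟨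
            iterate σ i (suc (b + (a ∸ b)))       ≡⟨ cong (λ x → iterate σ i (suc x)) (ℕ.m+[n∸m]≡n b≤a) ⟩
            iterate σ i (suc a)                   ≡⟨ p ⟩
            i′                                    ∎)
        = suc c , trans (cong (λ x → iterate (next ⟨$⟩ʳ_) x c) (turn⇒next t)) r
      advance : ∀ {j} → Turn i j → Reaches (next ⟨$⟩ʳ_) i i′
      advance t@(stay _) = resume z≤n t refl
      advance t@(below (_ , q))
        with b , b<a , r , _ ← exit a (_ , [] , q)
          (λ on → top⇒off q (let X , P , e = subst (On _) p on in X , P , trans eq e)) =
        resume b<a t r
      advance t@(above p′@(_ , q))
        with c , e ← pops⇒up p′
        with b , b<a , p″ ← enter a (top⇒off (stack-up e))
          (subst (On i) (sym p) (_ , [] , trans (sym eq) (stack-up e))) =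
        resume b<a t (pops-unique p″ p′)

  end : Fin m → Fin (suc s)
  end i = vertex letter (stack i)

  vertex-up : ∀ {j c} X → letter j ≡ up c → vertex letter (j ∷ X) ≡ inject₁ c
  vertex-up {j} X eq with letter j
  vertex-up X refl | up c = refl

  end-up : ∀ {i c} → letter i ≡ up c → end i ≡ inject₁ c
  end-up {i} eq = trans (cong (vertex letter) (stack-up eq)) (vertex-up (stack (σ i)) eq)

  -- The label determines the top entry since `up` letters are injective, and the top entry
  -- determines the whole stack by `top⇒stack`.
  end⇒stack : ∀ {i i′} → end i ≡ end i′ → stack i ≡ stack i′
  end⇒stack {i} {i′} eq with stack i in p | stack i′ in q
  ... | [] | [] = refl
  ... | [] | j ∷ X with c , e ← top⇒up q = contradiction (trans eq (vertex-up X e)) Fin.fromℕ≢inject₁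
  ... | j ∷ X | [] with c , e ← top⇒up p = contradiction (trans (sym eq) (vertex-up X e)) Fin.fromℕ≢inject₁
  ... | j ∷ X | j′ ∷ X′ with c , e ← top⇒up p | c′ , e′ ← top⇒up q
    with refl ← Fin.inject₁-injective (trans (sym (vertex-up X e)) (trans eq (vertex-up X′ e′)))
    with refl ← up-injective e e′ = trans (sym (top⇒stack p)) (top⇒stack q)

-- The tree-rooted map of a code.

isTree : ∀ {m s} → Letter m s → Side
isTree (chord _) = outside
isTree _         = inside

∈-tabulate⁺ : ∀ {m} {f : Fin m → Side} {i} → f i ≡ inside → i ∈ tabulate f
∈-tabulate⁺ {f = f} {i} eq = Vec.lookup⇒[]= i _ (trans (Vec.lookup∘tabulate f i) eq)

∈-tabulate⁻ : ∀ {m} {f : Fin m → Side} {i} → i ∈ tabulate f → f i ≡ inside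
∈-tabulate⁻ {f = f} {i} p = trans (sym (Vec.lookup∘tabulate f i)) (Vec.[]=⇒lookup p)

lookup-∷ʳ-inject₁ : ∀ {A : Set} {m} (v : Vec A m) x i → lookup (v ∷ʳ x) (inject₁ i) ≡ lookup v i
lookup-∷ʳ-inject₁ (y ∷ v) x zero    = refl
lookup-∷ʳ-inject₁ (y ∷ v) x (suc i) = lookup-∷ʳ-inject₁ v x i

module _ {s} (V : Subset s) where

  fromℕ∈vertexSet : fromℕ s ∈ vertexSet V
  fromℕ∈vertexSet = Sub.x∈p∪q⁺ (inj₁ (Sub.x∈⁅x⁆ (fromℕ s)))

  inject₁∈vertexSet : ∀ {c} → c ∈ V → inject₁ c ∈ vertexSet V
  inject₁∈vertexSet {c} p = Sub.x∈p∪q⁺ {p = ⁅ fromℕ s ⁆} {q = V ∷ʳ outside}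
    (inj₂ (Vec.lookup⇒[]= (inject₁ c) (V ∷ʳ outside) (trans (lookup-∷ʳ-inject₁ V outside c) (Vec.[]=⇒lookup p))))

  inject₁∈vertexSet⁻ : ∀ {c} → inject₁ c ∈ vertexSet V → c ∈ V
  inject₁∈vertexSet⁻ {c} p with Sub.x∈p∪q⁻ ⁅ fromℕ s ⁆ (V ∷ʳ outside) p
  ... | inj₁ q = contradiction (sym (Sub.x∈⁅y⁆⇒x≡y (fromℕ s) q)) Fin.fromℕ≢inject₁
  ... | inj₂ q = Vec.lookup⇒[]= c V (trans (sym (lookup-∷ʳ-inject₁ V outside c)) (Vec.[]=⇒lookup q))

module _ {n N} {W : Subset N} (G : Graph n W) where
  open Graph G

  adjacent-sym : ∀ {T u v} → IsEdgeSet G T → Adjacent G T u v → Adjacent G T v u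
  adjacent-sym closed (h , h∈T , p , q) = mate h , closed h h∈T , q , trans (cong end (mate-mate h)) p

  walk-reverse : ∀ {T u v} → IsEdgeSet G T → Star (Adjacent G T) u v → Star (Adjacent G T) v u
  walk-reverse closed ε       = ε
  walk-reverse closed (a ◅ w) = walk-reverse closed w ◅◅ (adjacent-sym closed a ◅ ε)

  connected-⊤ : ∀ {T} → Connected G T → Connected G ⊤
  connected-⊤ con u v u∈W v∈W = go (con u v u∈W v∈W)
    where
    go : ∀ {T u v} → Star (Adjacent G T) u v → Star (Adjacent G ⊤) u v
    go ε = ε
    go ((h , _ , p) ◅ w) = (h , Sub.∈⊤ , p) ◅ go w

firstPosition : ∀ m → Maybe (Fin m)
firstPosition zero    = nothing
firstPosition (suc m) = just zero

firstPosition-nothing : ∀ m → firstPosition m ≡ nothing → m ≡ 0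
firstPosition-nothing zero _ = refl

up? : ∀ {m s} (l : Letter m s) c → Dec (l ≡ up c)
up? (chord _) c = no λ ()
up? down      c = no λ ()
up? (up d)    c with d Fin.≟ c
... | yes refl = yes refl
... | no d≢c   = no λ where refl → d≢c refl

_≟down : ∀ {m s} (l : Letter m s) → Dec (l ≡ down)
chord _ ≟down = no λ ()
up _    ≟down = no λ ()
down    ≟down = yes refl

labels : ∀ {m s} → (Fin m → Letter m s) → Subset s
labels letter = tabulate λ c → does (Fin.any? λ i → up? (letter i) c)

module _ {m s} (letter : Fin m → Letter m s) {c : Fin s} where

  ∈-labels⁺ : ∀ {i} → letter i ≡ up c → c ∈ labels letter
  ∈-labels⁺ {i} eq = ∈-tabulate⁺ (dec-true (Fin.any? λ i → up? (letter i) c) (i , eq))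

  ∈-labels⁻ : c ∈ labels letter → ∃[ i ] letter i ≡ up c
  ∈-labels⁻ p with Fin.any? (λ i → up? (letter i) c) | ∈-tabulate⁻ {i = c} p
  ... | yes q | _ = q

module ContourMap {n s} {letter : Fin (2 * n) → Letter (2 * n) s} (isCode : IsCode letter) where

  open Contour isCode

  W : Subset (suc s)
  W = vertexSet (labels letter)

  end-∈ : ∀ i → end i ∈ W
  end-∈ i with stack i in eq
  ... | []    = fromℕ∈vertexSet (labels letter)
  ... | j ∷ X with c , e ← top⇒up eq =
    subst (_∈ W) (sym (vertex-up X e)) (inject₁∈vertexSet (labels letter) (∈-labels⁺ letter e))

  graph : Graph n W
  graph = record
    { end = end ; end-∈ = end-∈ ; mate = mate ; mate-mate = mate-mate ; mate-distinct = mate-distinct }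

  tree : Subset (2 * n)
  tree = tabulate (isTree ∘ letter)

  tree-up : ∀ {i c} → letter i ≡ up c → i ∈ tree
  tree-up eq = ∈-tabulate⁺ (cong isTree eq)

  tree-down : ∀ {i} → letter i ≡ down → i ∈ tree
  tree-down eq = ∈-tabulate⁺ (cong isTree eq)

  chord∉tree : ∀ {i j} → letter i ≡ chord j → i ∉ tree
  chord∉tree {i} eq p = case trans (sym (cong isTree eq)) (∈-tabulate⁻ {i = i} p) of λ ()

  tree⁻ : ∀ {i} → i ∈ tree → IsUp i ⊎ letter i ≡ down
  tree⁻ {i} p with letter i | ∈-tabulate⁻ {i = i} p
  ... | up c | _ = inj₁ (c , refl)
  ... | down | _ = inj₂ refl

  tree-mate : IsEdgeSet graph tree
  tree-mate i p with mate-spec i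
  ... | below pops       = tree-up (proj₂ (pops⇒up pops))
  ... | above (q , _)    = tree-down q
  ... | across q         = contradiction p (chord∉tree q)

  mate-up : ∀ {i} → IsUp i → Pops (mate i) i
  mate-up {i} (_ , eq) with mate-spec i
  ... | above pops    = pops
  ... | below (q , _) = case trans (sym eq) q of λ ()
  ... | across q      = case trans (sym eq) q of λ ()

  mate-down : ∀ {i} → letter i ≡ down → Pops i (mate i)
  mate-down {i} eq with mate-spec i
  ... | below pops = pops
  ... | above pops = case trans (sym eq) (proj₂ (pops⇒up pops)) of λ ()
  ... | across q   = case trans (sym eq) q of λ ()

  stack-mate-up : ∀ {i} → IsUp i → stack i ≡ i ∷ stack (mate i)
  stack-mate-up u = top⇒stack (proj₂ (mate-up u))

  stack-mate-down : ∀ {i} → letter i ≡ down → stack (mate i) ≡ mate i ∷ stack i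
  stack-mate-down eq = top⇒stack (proj₂ (mate-down eq))

  root-walk : ∀ i → Star (Adjacent graph tree) (end i) (fromℕ s)
  root-walk i = go (stack i) i refl
    where
    go : ∀ S i → stack i ≡ S → Star (Adjacent graph tree) (end i) (fromℕ s)
    go [] i eq rewrite eq = ε
    go (j ∷ S) i eq =
      (j , tree-up (proj₂ (top⇒up eq)) , cong (vertex letter) (trans (top⇒stack eq) (sym eq)) , refl) ◅
      go S (mate j) (List.∷-injectiveʳ (trans (sym (stack-mate-up (top⇒up eq))) (top⇒stack eq)))

  connected : Connected graph tree
  connected u v u∈W v∈W = toRoot u u∈W ◅◅ walk-reverse graph tree-mate (toRoot v v∈W)
    where
    toRoot : ∀ v → v ∈ W → Star (Adjacent graph tree) v (fromℕ s)
    toRoot v = go (view v)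
      where
      go : ∀ {v} → View v → v ∈ W → Star (Adjacent graph tree) v (fromℕ s)
      go ‵fromℕ _ = ε
      go (‵inj₁ _) v∈W with i , eq ← ∈-labels⁻ letter (inject₁∈vertexSet⁻ (labels letter) v∈W) =
        subst (λ x → Star (Adjacent graph tree) x (fromℕ s)) (end-up eq) (root-walk i)

  module _ {l} (cycle : Cycle graph tree l) where
    open Cycle cycle

    private
      Down : Fin (suc l) → Set
      Down i = letter (d i) ≡ down

      Follows : Fin (suc l) → Fin (suc l) → Set
      Follows i j = end (mate (d i)) ≡ end (d j)

      depth : Fin (suc l) → ℕ
      depth i = length (stack (d i))

      -- The only `up` half-edge at the vertex just reached is the mate of the half-edge just
      -- crossed, and a cycle may not return along it.
      down-persists : ∀ {i j} → Follows i j → Down i → Down j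
      down-persists {i} {j} p eq with tree⁻ (d-∈ j)
      ... | inj₂ q = q
      ... | inj₁ u = contradiction
        (List.∷-injectiveˡ (trans (sym (stack-mate-up u)) (trans (sym (end⇒stack p)) (stack-mate-down eq))))
        (edgeDistinct j i)

      up-persists : ∀ {i j} → Follows i j → ¬ Down j → ¬ Down i
      up-persists p ¬q q = ¬q (down-persists p q)

      down-deeper : ∀ {i j} → Follows i j → Down i → depth j ≡ suc (depth i)
      down-deeper p eq = cong length (trans (sym (end⇒stack p)) (stack-mate-down eq))

      up-shallower : ∀ {i j} → Follows i j → ¬ Down i → depth i ≡ suc (depth j)
      up-shallower {i} p ¬q with tree⁻ (d-∈ i)
      ... | inj₂ q = contradiction q ¬q
      ... | inj₁ u = trans (cong length (stack-mate-up u)) (cong (suc ∘ length) (end⇒stack p))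

      down-all : Down zero → ∀ i → Down i
      down-all p = <-weakInduction Down p λ i → down-persists (consecutive i)

      up-all : ¬ Down zero → ∀ i → ¬ Down i
      -- Being `up` propagates backwards along the cycle, so the induction starts at the last edge,
      -- reached from the first through `closed`.
      up-all p = >-weakInduction (¬_ ∘ Down) (up-persists closed p) λ i → up-persists (consecutive i)

    -- Along a cycle, a step away from s + 1 can only be followed by another one,
    -- so that the distance to s + 1 is monotone.
    no-cycle : ⊥
    no-cycle with letter (d zero) ≟down
    ... | yes p = ℕ.1+n≰n (ℕ.≤-trans (ℕ.≤-reflexive (sym (down-deeper closed (down-all p _))))
      (<-weakInduction (λ i → depth zero ≤ depth i) ℕ.≤-refl
        (λ i le → ℕ.≤-trans le (ℕ.≤-trans (ℕ.n≤1+n _) (ℕ.≤-reflexive (sym (down-deeper (consecutive i) (down-all p _))))))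
        (fromℕ l)))
    ... | no ¬p = ℕ.1+n≰n (ℕ.≤-trans (ℕ.≤-reflexive (sym (up-shallower closed (up-all ¬p _))))
      (<-weakInduction (λ i → depth i ≤ depth zero) ℕ.≤-refl
        (λ i le → ℕ.≤-trans (ℕ.n≤1+n _) (ℕ.≤-trans (ℕ.≤-reflexive (sym (up-shallower (consecutive i) (up-all ¬p _)))) le))
        (fromℕ l)))

  isSpanningTree : IsSpanningTree graph tree
  isSpanningTree = record { isEdgeSet = tree-mate ; connected = connected ; acyclic = λ _ → no-cycle }

  combMap : CombMap n W
  combMap = record
    { graph     = graph
    ; connected = connected-⊤ graph connected
    ; next      = next
    ; next-end  = λ i → cong (vertex letter) (stack-next i)
    ; next-full = λ i i′ eq → next-full (end⇒stack eq)
    }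

  -- For n = 0 there is no first half-edge, and s + 1 is the only vertex.
  rootAt : Maybe (Fin (2 * n)) → Fin (suc s)
  rootAt = Maybe.maybe′ end (fromℕ s)

  rootAt-∈ : ∀ f → rootAt f ∈ W
  rootAt-∈ (just i) = end-∈ i
  rootAt-∈ nothing  = fromℕ∈vertexSet (labels letter)

  isFirst : IsFirstAt combMap (rootAt (firstPosition (2 * n))) (firstPosition (2 * n))
  isFirst with firstPosition (2 * n) in eq
  ... | just i  = refl
  ... | nothing = λ i _ → case subst Fin (firstPosition-nothing (2 * n) eq) i of λ ()

  rootedMap : RootedMap n W
  rootedMap = record
    { combMap = combMap ; root = rootAt (firstPosition (2 * n)) ; root-∈ = rootAt-∈ (firstPosition (2 * n))
    ; first = firstPosition (2 * n) ; isFirst = isFirst }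

  treeRootedMap : TreeRootedMap n W
  treeRootedMap = record { rootedMap = rootedMap ; tree = tree ; isSpanningTree = isSpanningTree }

-- Reduced walks in a forest.

module Walks {n N} {W : Subset N} (G : Graph n W) (T : Subset (2 * n)) where
  open Graph G

  private
    H : Set
    H = Fin (2 * n)

  data IsWalk (v : Fin N) : Fin N → List H → Set where
    []   : IsWalk v v []
    cons : ∀ {u h w} → h ∈ T → end h ≡ u → IsWalk v (end (mate h)) w → IsWalk v u (h ∷ w)

  NoReturn : H → List H → Set
  NoReturn h []      = Unit
  NoReturn h (g ∷ _) = g ≢ mate h

  Reduced : List H → Set
  Reduced []      = Unit
  Reduced (h ∷ w) = NoReturn h w × Reduced w

  Simple : Fin N → List H → Set
  Simple v []      = Unit
  Simple v (h ∷ w) = All (λ g → end h ≢ end g) w × end h ≢ v × Simple v w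

  walk-consecutive : ∀ {u v h} P → IsWalk v u (h ∷ P) → ∀ (i : Fin (length P)) →
    end (mate (List.lookup (h ∷ P) (inject₁ i))) ≡ end (List.lookup (h ∷ P) (suc i))
  walk-consecutive (g ∷ P) (cons _ _ (cons _ eq _)) zero = sym eq
  walk-consecutive (g ∷ P) (cons _ _ w) (suc i) = walk-consecutive P w i

  walk-last : ∀ {u v h} P → IsWalk v u (h ∷ P) → end (mate (List.lookup (h ∷ P) (fromℕ (length P)))) ≡ v
  walk-last []      (cons _ _ []) = refl
  walk-last (g ∷ P) (cons _ _ w)  = walk-last P w

  walk-∈ : ∀ {u v w} → IsWalk v u w → ∀ i → List.lookup w i ∈ T
  walk-∈ (cons p _ w) zero    = p
  walk-∈ (cons p _ w) (suc i) = walk-∈ w i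

  reduced-consecutive : ∀ {h} P → Reduced (h ∷ P) → ∀ (i : Fin (length P)) →
    List.lookup (h ∷ P) (suc i) ≢ mate (List.lookup (h ∷ P) (inject₁ i))
  reduced-consecutive (g ∷ P) (p , _) zero    = p
  reduced-consecutive (g ∷ P) (_ , r) (suc i) = reduced-consecutive P r i

  simple-final : ∀ {v w} → Simple v w → ∀ i → end (List.lookup w i) ≢ v
  simple-final {w = h ∷ w} (_ , p , _) zero    = p
  simple-final {w = h ∷ w} (_ , _ , s) (suc i) = simple-final s i

  simple-injective : ∀ {v w} → Simple v w → Injective _≡_ _≡_ (λ i → end (List.lookup w i))
  simple-injective {w = h ∷ w} s {zero}  {zero}  eq = refl
  simple-injective {w = h ∷ w} s {zero}  {suc j} eq = contradiction eq (All.lookup (proj₁ s) (∈-lookup j))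
  simple-injective {w = h ∷ w} s {suc i} {zero}  eq = contradiction (sym eq) (All.lookup (proj₁ s) (∈-lookup i))
  simple-injective {w = h ∷ w} s {suc i} {suc j} eq = cong suc (simple-injective (proj₂ (proj₂ s)) eq)

  -- A backtracking at the basepoint of the closed walk would force its
  -- second and last edges to coincide, hence a backtracking elsewhere.
  closed⇒cycle : ∀ {h P} → IsWalk (end h) (end h) (h ∷ P) → Reduced (h ∷ P) → Simple (end h) P →
                 Cycle G T (length P)
  closed⇒cycle {h} {P} walk reduced simple = record
    { d = d ; d-∈ = walk-∈ walk ; consecutive = walk-consecutive P walk ; closed = walk-last P walk
    ; vertexDistinct = distinct ; edgeDistinct = λ i j → edge-distinct i (view j) }
    where
    d : Fin (suc (length P)) → H
    d = List.lookup (h ∷ P)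

    distinct : Injective _≡_ _≡_ (λ i → end (d i))
    distinct {zero}  {zero}  eq = refl
    distinct {zero}  {suc j} eq = contradiction (sym eq) (simple-final simple j)
    distinct {suc i} {zero}  eq = contradiction eq (simple-final simple i)
    distinct {suc i} {suc j} eq = cong suc (simple-injective simple eq)

    base : ∀ P → IsWalk (end h) (end h) (h ∷ P) → Reduced (h ∷ P) →
           Injective _≡_ _≡_ (λ i → end (List.lookup (h ∷ P) i)) →
           h ≢ mate (List.lookup (h ∷ P) (fromℕ (length P)))
    base [] _ _ _ eq = mate-distinct h (sym eq)
    base (g ∷ []) _ (p , _) _ eq = p (trans (sym (mate-mate g)) (cong mate (sym eq)))
    base (g ∷ f ∷ P) walk reduced distinct eq =
      case distinct {suc zero} {fromℕ (length (g ∷ f ∷ P))}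
        (trans (sym (walk-consecutive (g ∷ f ∷ P) walk zero))
               (trans (cong (end ∘ mate) eq) (cong end (mate-mate _)))) of λ ()

    edge-distinct : ∀ i {j} → View j → d i ≢ mate (d j)
    edge-distinct i (‵inj₁ {i = j} _) eq
      with refl ← distinct {i} {suc j} (trans (cong end eq) (walk-consecutive P walk j)) =
      reduced-consecutive P reduced j eq
    edge-distinct i ‵fromℕ eq with refl ← distinct {i} {zero} (trans (cong end eq) (walk-last P walk)) =
      base P walk reduced distinct eq

  prefix-walk : ∀ {u v w} → IsWalk v u w → ∀ i → IsWalk (end (List.lookup w i)) u (List.take (toℕ i) w)
  prefix-walk (cons p eq w) zero    = subst (λ x → IsWalk x _ []) (sym eq) []
  prefix-walk (cons p eq w) (suc i) = cons p eq (prefix-walk w i)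

  prefix-noReturn : ∀ {h} w k → NoReturn h w → NoReturn h (List.take k w)
  prefix-noReturn []      zero    _ = tt
  prefix-noReturn []      (suc k) _ = tt
  prefix-noReturn (g ∷ w) zero    _ = tt
  prefix-noReturn (g ∷ w) (suc k) p = p

  prefix-reduced : ∀ w k → Reduced w → Reduced (List.take k w)
  prefix-reduced w       zero    _ = tt
  prefix-reduced []      (suc k) _ = tt
  prefix-reduced (h ∷ w) (suc k) (p , r) = prefix-noReturn w k p , prefix-reduced w k r

  prefix-simple : ∀ {v} w → Simple v w → ∀ i → Simple (end (List.lookup w i)) (List.take (toℕ i) w)
  prefix-simple (h ∷ w) _           zero    = tt
  prefix-simple (h ∷ w) (p , _ , s) (suc i) =
    All.take⁺ (toℕ i) p , All.lookup p (∈-lookup i) , prefix-simple w s i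

  module _ (acyclic : ∀ m → ¬ Cycle G T m) where

    -- The tail is simple by induction. If its vertices include the starting vertex of h, the walk
    -- up to that visit is closed and reduced with a simple tail, hence a cycle.
    reduced⇒simple : ∀ {u v w} → IsWalk v u w → Reduced w → Simple v w
    reduced⇒simple [] _ = tt
    reduced⇒simple {v = v} (cons {h = h} {w} h∈T _ walk) (p , r) = All.tabulate elsewhere , open′ , simple
      where
      simple = reduced⇒simple walk r

      elsewhere : ∀ {g} → g Mem.∈ w → end h ≢ end g
      elsewhere {g} g∈w eq with i ← Any.index g∈w | refl ← lookup-index g∈w =
        acyclic _ (closed⇒cycle {P = List.take (toℕ i) w}
          (cons h∈T refl (subst (λ x → IsWalk x (end (mate h)) (List.take (toℕ i) w)) (sym eq) (prefix-walk walk i)))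
          (prefix-noReturn w (toℕ i) p , prefix-reduced w (toℕ i) r)
          (subst (λ x → Simple x (List.take (toℕ i) w)) (sym eq) (prefix-simple w simple i)))

      open′ : end h ≢ v
      open′ refl = acyclic _ (closed⇒cycle (cons h∈T refl walk) (p , r) simple)

    closed⇒[] : ∀ {u w} → IsWalk u u w → Reduced w → w ≡ []
    closed⇒[] [] _ = refl
    closed⇒[] walk@(cons _ eq _) r = contradiction eq (proj₁ (proj₂ (reduced⇒simple walk r)))

    private
      Branch : List H → List H → Set
      Branch []      _       = Unit
      Branch (_ ∷ _) []      = Unit
      Branch (h ∷ _) (g ∷ _) = h ≢ g

      -- The walk w backwards, followed by a. With the accumulator, `Branch` at the junction is the
      -- only new condition for the result to be reduced, and it is restored at each step.
      reverseOnto : List H → List H → List H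
      reverseOnto []      a = a
      reverseOnto (h ∷ w) a = reverseOnto w (mate h ∷ a)

      reverseOnto-walk : IsEdgeSet G T → ∀ {v x u w a} → IsWalk v u w → IsWalk x u a → IsWalk x v (reverseOnto w a)
      reverseOnto-walk closed [] walk′ = walk′
      reverseOnto-walk closed (cons {h = h} h∈T eq walk) walk′ = reverseOnto-walk closed walk
        (cons (closed h h∈T) refl (subst (λ z → IsWalk _ z _) (sym (trans (cong end (mate-mate h)) eq)) walk′))

      reverseOnto-reduced : ∀ w a → Reduced w → Reduced a → Branch w a → Reduced (reverseOnto w a)
      reverseOnto-reduced []      a _       r′ _ = r′
      reverseOnto-reduced (h ∷ w) a (p , r) r′ b =
        reverseOnto-reduced w (mate h ∷ a) r (noReturn a b , r′) (branch w p)
        where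
        noReturn : ∀ a → Branch (h ∷ w) a → NoReturn (mate h) a
        noReturn []      _ = tt
        noReturn (g ∷ a) b eq = b (sym (trans eq (mate-mate h)))
        branch : ∀ w → NoReturn h w → Branch w (mate h ∷ a)
        branch []      _ = tt
        branch (g ∷ w) p = p

      reverseOnto-nonempty : ∀ w h a → reverseOnto w (h ∷ a) ≢ []
      reverseOnto-nonempty (g ∷ w) h a eq = reverseOnto-nonempty w (mate g) (h ∷ a) eq

    -- After the common initial part is removed, one walk backwards followed by the other would be a
    -- closed reduced walk that is not empty.
    reduced-unique : IsEdgeSet G T → ∀ {u v w w′} → IsWalk v u w → Reduced w →
                     IsWalk v u w′ → Reduced w′ → w ≡ w′
    reduced-unique closed [] _ walk′ r′ = sym (closed⇒[] walk′ r′)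
    reduced-unique closed walk@(cons _ _ _) r [] r′ = closed⇒[] walk r
    reduced-unique closed walk@(cons {h = h} {w} _ _ walk₁) r walk′@(cons {h = h′} {w′} _ _ walk′₁) r′
      with h Fin.≟ h′
    ... | yes refl = cong (h ∷_) (reduced-unique closed walk₁ (proj₂ r) walk′₁ (proj₂ r′))
    ... | no h≢h′ = contradiction
      (closed⇒[] (reverseOnto-walk closed walk walk′) (reverseOnto-reduced (h ∷ w) (h′ ∷ w′) r r′ h≢h′))
      (reverseOnto-nonempty w (mate h) (h′ ∷ w′))

  prepend : ∀ {h v w} → h ∈ T → IsWalk v (end (mate h)) w → Reduced w →
            ∃[ w′ ] IsWalk v (end h) w′ × Reduced w′ × (w′ ≡ h ∷ w ⊎ w ≡ mate h ∷ w′)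
  prepend {h} {w = []} h∈T walk r = h ∷ [] , cons h∈T refl walk , (tt , r) , inj₁ refl
  prepend {h} {w = g ∷ w} h∈T walk@(cons _ eq walk₁) r with g Fin.≟ mate h
  ... | yes refl = w , subst (λ x → IsWalk _ x _) (cong end (mate-mate h)) walk₁ , proj₂ r , inj₂ refl
  ... | no g≢    = h ∷ g ∷ w , cons h∈T refl walk , (g≢ , r) , inj₁ refl

  reduced-exists : ∀ {u v} → Star (Adjacent G T) u v → ∃[ w ] IsWalk v u w × Reduced w
  reduced-exists ε = [] , [] , tt
  reduced-exists ((h , h∈T , refl , refl) ◅ star) with w , walk , r ← reduced-exists star
    with w′ , walk′ , r′ , _ ← prepend h∈T walk r = w′ , walk′ , r′

-- The tour of a spanning tree visits every half-edge.

module Tour {n N} {W : Subset N} (M : TreeRootedMap n W) {ρ : Fin N} (ρ∈W : ρ ∈ W) where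
  open TreeRootedMap M
  open IsSpanningTree isSpanningTree using (isEdgeSet; acyclic) renaming (connected to tree-connected)
  open Walks graph tree public

  private
    H : Set
    H = Fin (2 * n)

  tree? : ∀ h → Dec (h ∈ tree)
  tree? h = h Sub.∈? tree

  turnʳ : H → H
  turnʳ h with tree? h
  ... | yes _ = mate h
  ... | no _  = h

  turn-∈ : ∀ {h} → h ∈ tree → turnʳ h ≡ mate h
  turn-∈ {h} p with tree? h
  ... | yes _ = refl
  ... | no ¬p = contradiction p ¬p

  turn-∉ : ∀ {h} → h ∉ tree → turnʳ h ≡ h
  turn-∉ {h} ¬p with tree? h
  ... | yes p = contradiction p ¬p
  ... | no _  = refl

  turn-turn : ∀ h → turnʳ (turnʳ h) ≡ h
  turn-turn h = case tree? h of λ where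
    (yes p) → trans (cong turnʳ (turn-∈ p)) (trans (turn-∈ (isEdgeSet h p)) (mate-mate h))
    (no ¬p) → trans (cong turnʳ (turn-∉ ¬p)) (turn-∉ ¬p)

  tour : Permutation′ (2 * n)
  tour = Perm.permutation turnʳ turnʳ turn-turn turn-turn ∘ₚ next

  τ : H → H
  τ = tour ⟨$⟩ʳ_

  τ-injective : Injective _≡_ _≡_ τ
  τ-injective = permutation-injective tour

  private
    walk-to-ρ : ∀ {v} → v ∈ W → ∃[ w ] IsWalk ρ v w × Reduced w
    walk-to-ρ v∈W = reduced-exists (tree-connected _ ρ v∈W ρ∈W)

  path : H → List H
  path h = proj₁ (walk-to-ρ (end-∈ h))

  path-walk : ∀ h → IsWalk ρ (end h) (path h)
  path-walk h = proj₁ (proj₂ (walk-to-ρ (end-∈ h)))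

  path-reduced : ∀ h → Reduced (path h)
  path-reduced h = proj₂ (proj₂ (walk-to-ρ (end-∈ h)))

  path-unique : ∀ {h w} → IsWalk ρ (end h) w → Reduced w → path h ≡ w
  path-unique {h} = reduced-unique acyclic isEdgeSet (path-walk h) (path-reduced h)

  end⇒path : ∀ {h h′} → end h ≡ end h′ → path h ≡ path h′
  end⇒path {h} {h′} eq = path-unique (subst (λ x → IsWalk ρ x (path h′)) (sym eq) (path-walk h′)) (path-reduced h′)

  path-next : ∀ h → path (next ⟨$⟩ʳ h) ≡ path h
  path-next h = end⇒path (next-end h)

  IsUp : H → Set
  IsUp h = path h ≡ h ∷ path (mate h)

  head⇒up : ∀ {h w} → path h ≡ h ∷ w → h ∈ tree × IsUp h
  head⇒up {h} {w} eq with subst (IsWalk ρ (end h)) eq (path-walk h) | subst Reduced eq (path-reduced h)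
  ... | cons h∈T _ walk | _ , r = h∈T , trans eq (cong (h ∷_) (sym (path-unique walk r)))

  head-up : ∀ {h g w} → path h ≡ g ∷ w → g ∈ tree × end g ≡ end h × IsUp g
  head-up {h} {g} eq with subst (IsWalk ρ (end h)) eq (path-walk h)
  ... | cons _ q _ with g∈T , u ← head⇒up (trans (end⇒path q) eq) = g∈T , q , u

  -- Prepending h to the path from its far end either yields the path from its near end or cancels
  -- the first step of the path, which is then `mate h`.
  up-either : ∀ h → h ∈ tree → IsUp h ⊎ IsUp (mate h)
  up-either h h∈T with prepend h∈T (path-walk (mate h)) (path-reduced (mate h))
  ... | w , walk , r , inj₁ refl = inj₁ (path-unique walk r)
  ... | w , walk , r , inj₂ eq   = inj₂ (trans eq (cong (mate h ∷_) (sym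
    (trans (cong path (mate-mate h)) (path-unique walk r)))))

  up-exclusive : ∀ {h} → IsUp h → ¬ IsUp (mate h)
  up-exclusive {h} u u′ = ℕ.m≢1+n+m (length (path h)) {1} (begin
    length (path h)                       ≡⟨ cong length u ⟩
    suc (length (path (mate h)))          ≡⟨ cong (suc ∘ length) u′ ⟩
    2 + length (path (mate (mate h)))     ≡⟨ cong (λ g → 2 + length (path g)) (mate-mate h) ⟩
    2 + length (path h)                   ∎)
    where open ≡-Reasoning

  up-unique : ∀ {h h′} → end h ≡ end h′ → IsUp h → IsUp h′ → h ≡ h′
  up-unique eq u u′ = List.∷-injectiveˡ (trans (sym u) (trans (end⇒path eq) u′))

  path-bounded : ∀ h → length (path h) ≤ N
  path-bounded h = Fin.injective⇒≤ (simple-injective (reduced⇒simple acyclic (path-walk h) (path-reduced h)))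

  private
    _~_ : H → H → Set
    _~_ = Reaches τ

    ~-sym : ∀ {g h} → g ~ h → h ~ g
    ~-sym = reaches-sym τ τ-injective

    ~-trans : ∀ {f g h} → f ~ g → g ~ h → f ~ h
    ~-trans = reaches-trans τ

    ~-refl : ∀ {h} → h ~ h
    ~-refl = 0 , refl

    ~-reflexive : ∀ {g h} → g ≡ h → g ~ h
    ~-reflexive eq = 0 , eq

    turn~next : ∀ h → turnʳ h ~ (next ⟨$⟩ʳ h)
    turn~next h = 1 , cong (next ⟨$⟩ʳ_) (turn-turn h)

    -- The rotation is followed only until it arrives at u, so nothing has to be known about leaving
    -- u; in `up~mate` this is what remains to be proved.
    around : ∀ {u} → (∀ g → end g ≡ end u → g ≢ u → (next ⟨$⟩ʳ g) ~ g) →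
             ∀ m g → end g ≡ end u → iterate (next ⟨$⟩ʳ_) g m ≡ u → g ~ u
    around step zero    g eq p = ~-reflexive p
    around {u} step (suc m) g eq p with g Fin.≟ u
    ... | yes g≡u = ~-reflexive g≡u
    ... | no g≢u  = ~-trans (~-sym (step g eq g≢u))
      (around step m (next ⟨$⟩ʳ g) (trans (next-end g) eq) p)

    -- Descending induction on the distance to ρ: the tour of the part of the
    -- tree beyond an edge returns along that edge.
    up~mate : ∀ k u → u ∈ tree → IsUp u → N < length (path u) + k → u ~ mate u
    -- The bound k cannot run out: a reduced path is simple and so has at most N edges.
    up~mate zero    u _ _ N<l = contradiction (path-bounded u)
      (ℕ.<⇒≱ (subst (N <_) (ℕ.+-identityʳ _) N<l))
    up~mate (suc k) u u∈T up-u N<l = ~-sym (~-trans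
      (~-trans (~-reflexive (sym (turn-∈ u∈T))) (turn~next u))
      (let m , p = next-full (next ⟨$⟩ʳ u) u (next-end u) in
       around next~′ m (next ⟨$⟩ʳ u) (next-end u) p))
      where
      turn~ : ∀ g → end g ≡ end u → g ≢ u → turnʳ g ~ g
      turn~ g eq g≢u with tree? g
      ... | no _ = ~-refl
      ... | yes g∈T with up-either g g∈T
      ...   | inj₁ up-g = contradiction (up-unique eq up-g up-u) g≢u
      ...   | inj₂ up-m = subst (mate g ~_) (mate-mate g) (up~mate k (mate g) (isEdgeSet g g∈T) up-m
        (subst (N <_) (trans (ℕ.+-suc _ k) (cong (_+ k) (sym deeper))) N<l))
        where
        deeper : length (path (mate g)) ≡ suc (length (path u))
        deeper = trans (cong length up-m) (cong (suc ∘ length) (trans (cong path (mate-mate g)) (end⇒path eq)))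
      next~′ : ∀ g → end g ≡ end u → g ≢ u → (next ⟨$⟩ʳ g) ~ g
      next~′ g eq g≢u = ~-trans (~-sym (turn~next g)) (turn~ g eq g≢u)

    mate~ : ∀ h → h ∈ tree → h ~ mate h
    mate~ h h∈T with up-either h h∈T
    ... | inj₁ u = up~mate (suc N) h h∈T u (ℕ.m≤n+m (suc N) _)
    ... | inj₂ u = ~-sym (subst (mate h ~_) (mate-mate h)
                     (up~mate (suc N) (mate h) (isEdgeSet h h∈T) u (ℕ.m≤n+m (suc N) _)))

    next~ : ∀ h → h ~ (next ⟨$⟩ʳ h)
    next~ h = ~-trans turn~ (turn~next h)
      where
      turn~ : h ~ turnʳ h
      turn~ with tree? h
      ... | yes p = mate~ h p
      ... | no _  = ~-refl

    same-end~ : ∀ {g h} → end g ≡ end h → g ~ h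
    same-end~ {g} {h} eq with m , p ← next-full g h eq = go m g p
      where
      go : ∀ m g → iterate (next ⟨$⟩ʳ_) g m ≡ h → g ~ h
      go zero    g p = ~-reflexive p
      go (suc m) g p = ~-trans (next~ g) (go m (next ⟨$⟩ʳ g) p)

  -- Half-edges at one vertex share an orbit, the two sides of a tree edge share an orbit, and the
  -- tree connects all vertices.
  tour-transitive : Transitive τ
  tour-transitive g h = go (tree-connected (end g) (end h) (end-∈ g) (end-∈ h)) g refl
    where
    go : ∀ {u} → Star (Adjacent graph tree) u (end h) → ∀ g → end g ≡ u → g ~ h
    go ε g eq = same-end~ eq
    go ((f , f∈T , p , q) ◅ w) g eq =
      ~-trans (same-end~ (trans eq (sym p))) (~-trans (mate~ f f∈T) (go w (mate f) q))

-- Reading the code of a tree-rooted map.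

module Reading {n s} {V : Subset s} (M : TreeRootedMap n (vertexSet V)) where
  open TreeRootedMap M
  open IsSpanningTree isSpanningTree using (isEdgeSet) renaming (connected to tree-connected)
  open Tour M (fromℕ∈vertexSet V)

  private
    H : Set
    H = Fin (2 * n)

  -- φ sends a position in the tour to the half-edge at that position.
  data Reads (φ : Permutation′ (2 * n)) (h : H) : Letter (2 * n) s → Set where
    chord : ∀ {j} → h ∉ tree → φ ⟨$⟩ʳ j ≡ mate h → Reads φ h (chord j)
    up    : ∀ {c} → h ∈ tree → IsUp h → end h ≡ inject₁ c → Reads φ h (up c)
    down  : h ∈ tree → IsUp (mate h) → Reads φ h down

  -- A property of the word rather than a function of the map: the order φ may come from iterating
  -- τ, or be the identity when the map was built from the word.
  record Realizes (letter : H → Letter (2 * n) s) : Set where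
    field
      φ       : Permutation′ (2 * n)
      φ-first : first ≡ Maybe.map (φ ⟨$⟩ʳ_) (firstPosition (2 * n))
      φ-tour  : ∀ i → φ ⟨$⟩ʳ (shiftʳ i) ≡ τ (φ ⟨$⟩ʳ i)
      reads   : ∀ i → Reads φ (φ ⟨$⟩ʳ i) (letter i)

  private
    double-up : ∀ {h} {A : Set} → IsUp h → IsUp (mate h) → A
    double-up u u′ = contradiction u′ (up-exclusive u)

  reads-unique : ∀ {φ h l l′} → Reads φ h l → Reads φ h l′ → l ≡ l′
  reads-unique {φ} (chord _ p) (chord _ q) = cong chord (permutation-injective φ (trans p (sym q)))
  reads-unique (up _ _ p) (up _ _ q) = cong up (Fin.inject₁-injective (trans (sym p) q))
  reads-unique (down _ _) (down _ _) = refl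
  reads-unique (chord p _) (up q _ _) = contradiction q p
  reads-unique (chord p _) (down q _) = contradiction q p
  reads-unique (up q _ _)  (chord p _) = contradiction q p
  reads-unique (down q _)  (chord p _) = contradiction q p
  reads-unique (up _ u _)  (down _ u′) = double-up u u′
  reads-unique (down _ u′) (up _ u _)  = double-up u u′

  -- At s + 1 the reduced path is empty, so no half-edge there can be its first step.
  up-end : ∀ {h} → IsUp h → ∃[ c ] end h ≡ inject₁ c
  up-end {h} u = go (view (end h)) refl
    where
    go : ∀ {v} → View v → end h ≡ v → ∃[ c ] end h ≡ inject₁ c
    go (‵inj₁ {i = c} _) eq = c , eq
    go ‵fromℕ eq = case trans (sym u) (path-unique (subst (λ x → IsWalk (fromℕ s) x []) (sym eq) []) tt) of λ ()

  reads-exists : ∀ φ h → ∃[ l ] Reads φ h l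
  reads-exists φ h with tree? h
  ... | no h∉T  = _ , chord h∉T (Perm.inverseʳ φ)
  ... | yes h∈T with up-either h h∈T
  ...   | inj₁ u with c , eq ← up-end u = _ , up h∈T u eq
  ...   | inj₂ u = _ , down h∈T u

  path-[] : ∀ {h} → path h ≡ [] → end h ≡ fromℕ s
  path-[] {h} eq = go (subst (IsWalk (fromℕ s) (end h)) eq (path-walk h))
    where
    go : ∀ {u v} → IsWalk v u [] → u ≡ v
    go [] = refl

  -- By connectedness an isolated root leaves room for no edge; a missing first half-edge therefore
  -- goes with the empty word.
  no-vertex-outside : ∀ r → r ∈ vertexSet V → (∀ h → end h ≢ r) → ¬ H
  no-vertex-outside r r∈W isolated h with tree-connected r (end h) r∈W (end-∈ h)
  ... | ε = isolated h refl
  ... | (g , _ , p , _) ◅ _ = isolated g p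

  root-unique : ¬ H → root ≡ fromℕ s
  root-unique empty with tree-connected root (fromℕ s) root-∈ (fromℕ∈vertexSet V)
  ... | ε = refl
  ... | (g , _) ◅ _ = contradiction g empty

  private
    start : ∀ {m} (x : Fin m) {A : Set} (f : Fin m → A) {y} → (∀ i → toℕ i ≡ 0 → f i ≡ y) →
            just y ≡ Maybe.map f (firstPosition m)
    start {suc m} x f p = cong just (sym (p zero refl))

    empty : ∀ {m} → ¬ Fin m → ∀ {A : Set} (f : Fin m → A) → nothing ≡ Maybe.map f (firstPosition m)
    empty {zero}  _ f = refl
    empty {suc m} p f = contradiction zero p

    fromOrder : (φ : Permutation′ (2 * n)) → first ≡ Maybe.map (φ ⟨$⟩ʳ_) (firstPosition (2 * n)) →
                (∀ i → φ ⟨$⟩ʳ (shiftʳ i) ≡ τ (φ ⟨$⟩ʳ i)) → ∃[ letter ] Realizes letter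
    fromOrder φ p q = (λ i → proj₁ (reads-exists φ (φ ⟨$⟩ʳ i))) , record
      { φ = φ ; φ-first = p ; φ-tour = q ; reads = λ i → proj₂ (reads-exists φ (φ ⟨$⟩ʳ i)) }

  realization : ∃[ letter ] Realizes letter
  realization with first in eq | isFirst
  ... | just x  | _ = fromOrder
    (injective⇒permutation (λ i → iterate τ x (toℕ i)) (orbit-injective τ τ-injective tour-transitive x))
    (trans eq (start x (λ i → iterate τ x (toℕ i)) (λ i p → cong (iterate τ x) p)))
    (orbit-shift τ τ-injective tour-transitive x)
  ... | nothing | p = fromOrder Perm.id (trans eq (empty no-half-edge id)) (λ i → contradiction i no-half-edge)
    where no-half-edge = no-vertex-outside root root-∈ p

  module _ {letter : H → Letter (2 * n) s} (realizes : Realizes letter) where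
    open Realizes realizes

    private
      h : H → H
      h = φ ⟨$⟩ʳ_

      h⁻¹ : H → H
      h⁻¹ = φ ⟨$⟩ˡ_

      hh⁻¹ : ∀ g → h (h⁻¹ g) ≡ g
      hh⁻¹ g = Perm.inverseʳ φ

      h-injective : Injective _≡_ _≡_ h
      h-injective = permutation-injective φ

      partner : H → H
      partner i = h⁻¹ (mate (h i))

      stackOf : H → List H
      stackOf i = List.map h⁻¹ (path (h i))

      letter-unique : ∀ {i l} → Reads φ (h i) l → letter i ≡ l
      letter-unique {i} r = reads-unique (reads i) r

      reads-at : ∀ {i l} → letter i ≡ l → Reads φ (h i) l
      reads-at {i} eq = subst (Reads φ (h i)) eq (reads i)

      partner-partner : ∀ i → partner (partner i) ≡ i
      partner-partner i = trans (cong (h⁻¹ ∘ mate) (hh⁻¹ _)) (trans (cong h⁻¹ (mate-mate _)) (Perm.inverseˡ φ))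

      -- The source of `balanced`: reindexing along the edge involution turns the count of `up`
      -- letters into that of `down` letters.
      partner-down : ∀ i → isUp (letter i) ≡ isDown (letter (partner i))
      partner-down i with letter i | reads i
      ... | chord j | chord p q = sym (cong isDown (letter-unique (chord {j = i}
        (λ r → p (subst (_∈ tree) (mate-mate (h i)) (isEdgeSet _ (subst (_∈ tree) (hh⁻¹ _) r))))
        (sym (trans (cong mate (hh⁻¹ _)) (mate-mate (h i)))))))
      ... | up c | up p u _ = sym (cong isDown (letter-unique (down
        (subst (_∈ tree) (sym (hh⁻¹ _)) (isEdgeSet _ p))
        (subst IsUp (sym (trans (cong mate (hh⁻¹ _)) (mate-mate (h i)))) u))))
      ... | down | down p u with c , eq ← up-end u = sym (cong isDown (letter-unique (up
        (subst (_∈ tree) (sym (hh⁻¹ _)) (isEdgeSet _ p))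
        (subst IsUp (sym (hh⁻¹ _)) u)
        (trans (cong end (hh⁻¹ _)) eq))))

    realizes⇒isCode : IsCode letter
    realizes⇒isCode = record
      { chord-sym = λ eq → case reads-at eq of λ where
          (chord p q) → letter-unique (chord
            (λ r → p (subst (_∈ tree) (trans (cong mate q) (mate-mate _)) (isEdgeSet _ r)))
            (sym (trans (cong mate q) (mate-mate _))))
      ; chord-irrefl = λ eq → case reads-at eq of λ where
          (chord p q) → mate-distinct _ (sym q)
      ; up-injective = λ eq eq′ → case (reads-at eq , reads-at eq′) of λ where
          (up _ u p , up _ u′ p′) → h-injective (up-unique (trans p (sym p′)) u u′)
      ; balanced = trans (∑-cong partner-down)
          (sym (sum-permute (isDown ∘ letter) (Perm.permutation partner partner partner-partner partner-partner)))
      }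

    -- The path from a vertex c in V to s + 1 is not empty, and its first half-edge is read as
    -- `up c`.
    labels-realized : V ≡ labels letter
    labels-realized = Sub.⊆-antisym to from
      where
      to : V Sub.⊆ labels letter
      to {c} c∈V with reduced-exists (tree-connected (inject₁ c) (fromℕ s) (inject₁∈vertexSet V c∈V) (fromℕ∈vertexSet V))
      ... | w , walk , r = go walk r refl
        where
        go : ∀ {v w} → IsWalk (fromℕ s) v w → Reduced w → v ≡ inject₁ c → c ∈ labels letter
        go [] _ eq = contradiction eq Fin.fromℕ≢inject₁
        go walk@(cons {h = g} p q _) r eq
          with _ , u ← head⇒up (path-unique (subst (λ x → IsWalk (fromℕ s) x _) (sym q) walk) r) =
          ∈-labels⁺ letter (letter-unique (up (subst (_∈ tree) (sym (hh⁻¹ g)) p)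
            (subst IsUp (sym (hh⁻¹ g)) u) (trans (cong end (hh⁻¹ g)) (trans q eq))))
      from : labels letter Sub.⊆ V
      from c∈ with i , eq ← ∈-labels⁻ letter c∈ with up _ _ p ← reads-at eq =
        inject₁∈vertexSet⁻ V (subst (_∈ vertexSet V) p (end-∈ (h i)))

    private
      path-shift : ∀ i → path (h (shiftʳ i)) ≡ path (turnʳ (h i))
      path-shift i = trans (cong path (φ-tour i)) (path-next (turnʳ (h i)))

      stack-push : ∀ {i a} → step letter i ≡ push a → stackOf i ≡ a ∷ stackOf (shiftʳ i)
      stack-push {i} eq with letter i | reads i
      stack-push {i} refl | up c | up p u _ = begin
        List.map h⁻¹ (path (h i))                  ≡⟨ cong (List.map h⁻¹) u ⟩
        h⁻¹ (h i) ∷ List.map h⁻¹ (path (mate (h i))) ≡⟨ cong₂ (λ j w → j ∷ List.map h⁻¹ w) (Perm.inverseˡ φ)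
                                                         (trans (cong path (sym (turn-∈ p))) (sym (path-shift i))) ⟩
        i ∷ List.map h⁻¹ (path (h (shiftʳ i)))     ∎
        where open ≡-Reasoning

    path-pops : ∀ {i} → h i ∈ tree → IsUp (mate (h i)) → stackOf (shiftʳ i) ≡ partner i ∷ stackOf i
    path-pops {i} p u = begin
      List.map h⁻¹ (path (h (shiftʳ i)))   ≡⟨ cong (List.map h⁻¹) (trans (path-shift i) (cong path (turn-∈ p))) ⟩
      List.map h⁻¹ (path (mate (h i)))     ≡⟨ cong (List.map h⁻¹) u ⟩
      partner i ∷ List.map h⁻¹ (path (mate (mate (h i)))) ≡⟨ cong (λ g → partner i ∷ List.map h⁻¹ (path g)) (mate-mate (h i)) ⟩
      partner i ∷ stackOf i                ∎
      where open ≡-Reasoning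

    private
      stack-pop : ∀ {i} → step letter i ≡ pop → ∃[ a ] stackOf (shiftʳ i) ≡ a ∷ stackOf i
      stack-pop {i} eq with letter i | reads i
      ... | down | down p u = partner i , path-pops p u

      stack-skip : ∀ {i} → step letter i ≡ skip → stackOf i ≡ stackOf (shiftʳ i)
      stack-skip {i} eq with letter i | reads i
      ... | chord j | chord p _ = cong (List.map h⁻¹) (sym (trans (path-shift i) (cong path (turn-∉ p))))

      -- Needed for `bottom`: the mate of the last step of a walk to s + 1 is a half-edge at s + 1,
      -- whose path is empty.
      ends-at-ρ : ∀ {v w} → IsWalk (fromℕ s) v w → (∃[ g ] end g ≡ v) → ∃[ g ] end g ≡ fromℕ s
      ends-at-ρ [] eq = eq
      ends-at-ρ (cons {h = g} _ _ walk) _ = ends-at-ρ walk (mate g , refl)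

      bottom : H → ∃[ i ] stackOf i ≡ []
      bottom i with g , eq ← ends-at-ρ (path-walk i) (i , refl) = h⁻¹ g , cong (List.map h⁻¹)
        (path-unique (subst (λ x → IsWalk (fromℕ s) x []) (sym (trans (cong end (hh⁻¹ g)) eq)) []) tt)

    -- Makes the tree paths comparable with the stacks computed from the word through
    -- `stacks-unique`.
    pathStacks : Stacks (step letter)
    pathStacks = record
      { stack = stackOf ; stack-push = stack-push ; stack-pop = stack-pop ; stack-skip = stack-skip ; bottom = bottom }

-- Codes correspond to isomorphism classes of maps.

module _ {A : Set} {m} {w : Fin m → Step A} (S S′ : Stacks w) where

  private
    module S  = Stacks S
    module S′ = Stacks S′

  -- At a pop, `stack-pop` guarantees that the removed entry belongs to S, so Y underneath is not
  -- touched.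
  stacks-extend : ∀ {Y} i → S′.stack (shiftʳ i) ≡ S.stack (shiftʳ i) ++ Y → S′.stack i ≡ S.stack i ++ Y
  stacks-extend {Y} i eq with w i in e
  ... | push a = trans (S′.stack-push e) (trans (cong (a ∷_) eq) (cong (_++ Y) (sym (S.stack-push e))))
  ... | skip   = trans (S′.stack-skip e) (trans eq (cong (_++ Y) (sym (S.stack-skip e))))
  ... | pop    with a , p ← S.stack-pop e | a′ , p′ ← S′.stack-pop e =
    List.∷-injectiveʳ (trans (sym p′) (trans eq (cong (_++ Y) p)))

  -- Reading from a position where the first stack is empty shows that they
  -- differ by a constant bottom part, which is empty since the second stack
  -- is empty somewhere too.
  stacks-unique : ∀ i → S.stack i ≡ S′.stack i
  stacks-unique i with b , p ← S.bottom i | b′ , p′ ← S′.bottom i =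
    trans (sym (List.++-identityʳ _)) (trans (cong (S.stack i ++_) (sym Y≡[])) (sym (extends i)))
    where
    Y = S′.stack b
    extends : ∀ i → S′.stack i ≡ S.stack i ++ Y
    extends i with a , q ← shift-transitive i b = go a i q
      where
      go : ∀ a i → iterate shiftʳ i a ≡ b → S′.stack i ≡ S.stack i ++ Y
      go zero    i refl = cong (_++ Y) (sym p)
      go (suc a) i q    = stacks-extend i (go a (shiftʳ i) q)
    Y≡[] : Y ≡ []
    Y≡[] = List.++-conicalʳ (S.stack b′) Y (trans (sym (extends b′)) p′)

module _ {n s} {V : Subset s} (M : TreeRootedMap n (vertexSet V))
         {letter : Fin (2 * n) → Letter (2 * n) s} (isCode : IsCode letter) where
  open Reading M
  open Tour M (fromℕ∈vertexSet V)
  private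
    module M = TreeRootedMap M
    M-isEdgeSet = IsSpanningTree.isEdgeSet M.isSpanningTree
    module C where
      open ContourMap {n} isCode public
      open Contour isCode public

  -- Since stacks are unique, the stacks of the code are the tree paths of M. Ends and mates are
  -- read off from them, and the rotation follows from the tour.
  realizes⇒iso : Realizes letter → Iso C.treeRootedMap M
  realizes⇒iso realizes = record
    { φ = φ ; φ-end = φ-end ; φ-mate = λ i → sym (φ-mate i) ; φ-next = φ-next
    ; φ-root = φ-root ; φ-first = φ-first
    ; φ-tree = λ i → trans (φ-tree i) (sym (Vec.lookup∘tabulate (isTree ∘ letter) i)) }
    where
    open Realizes realizes

    h = φ ⟨$⟩ʳ_

    pathStack = Stacks.stack (pathStacks realizes)

    stack≡ : ∀ i → C.stack i ≡ pathStack i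
    stack≡ = stacks-unique C.contourStacks (pathStacks realizes)

    pops : ∀ {i j} → letter i ≡ down → h j ≡ M.mate (h i) → C.Pops i j
    pops {i} {j} eq q with subst (Reads φ (h i)) eq (reads i)
    ... | down p u = eq , trans (stack≡ (shiftʳ i)) (trans (path-pops realizes p u)
      (cong₂ _∷_ (trans (cong (φ ⟨$⟩ˡ_) (sym q)) (Perm.inverseˡ φ)) (sym (stack≡ i))))

    partner : ∀ i {j} → h j ≡ M.mate (h i) → C.Mate i j
    partner i {j} q with letter i in eq | reads i
    ... | chord k | chord _ p = C.across (trans eq (cong chord (permutation-injective φ (trans p (sym q)))))
    ... | down    | down _ _  = C.below (pops eq q)
    -- An `up` half-edge is treated from its partner, whose letter is `down` and where the pop takes
    -- place.
    ... | up c    | up p u _  = C.above (pops (reads-unique (reads j)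
      (down (subst (_∈ M.tree) (sym q) (M-isEdgeSet _ p)) (subst IsUp (sym q′) u))) (sym q′))
      where q′ = trans (cong M.mate q) (M.mate-mate (h i))

    φ-mate : ∀ i → h (C.mate i) ≡ M.mate (h i)
    φ-mate i = trans (cong h (C.mate-unique (C.mate-spec i) (partner i (Perm.inverseʳ φ)))) (Perm.inverseʳ φ)

    φ-end : ∀ i → M.end (h i) ≡ C.end i
    φ-end i = go (path (h i)) refl
      where
      go : ∀ w → path (h i) ≡ w → M.end (h i) ≡ C.end i
      go [] eq = trans (path-[] eq) (sym (cong (vertex letter) (trans (stack≡ i) (cong (List.map (φ ⟨$⟩ˡ_)) eq))))
      go (g ∷ w) eq with p , q , u ← head-up eq with c , e ← up-end u = begin
        M.end (h i)               ≡⟨ q ⟨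
        M.end g                   ≡⟨ e ⟩
        inject₁ c                 ≡⟨ C.vertex-up (List.map (φ ⟨$⟩ˡ_) w) (reads-unique (reads (φ ⟨$⟩ˡ g)) (up
                                       (subst (_∈ M.tree) (sym hg) p) (subst IsUp (sym hg) u) (trans (cong M.end hg) e))) ⟨
        vertex letter (List.map (φ ⟨$⟩ˡ_) (g ∷ w)) ≡⟨ cong (vertex letter) (trans (stack≡ i) (cong (List.map (φ ⟨$⟩ˡ_)) eq)) ⟨
        C.end i                   ∎
        where
        open ≡-Reasoning
        hg = Perm.inverseʳ φ {g}

    turn-turn′ : ∀ {i j} → C.Turn i j → turnʳ (h j) ≡ h i
    turn-turn′ {i} (C.stay eq) with subst (Reads φ (h i)) eq (reads i)
    ... | chord p _ = turn-∉ p
    turn-turn′ {i} {j} (C.below p) with _ , eq ← C.pops⇒up p | refl ← C.mate-unique (C.mate-spec i) (C.below p)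
      with subst (Reads φ (h j)) eq (reads j)
    ... | up q _ _ = trans (turn-∈ q) (trans (cong M.mate (φ-mate i)) (M.mate-mate (h i)))
    turn-turn′ {i} {j} (C.above p) with refl ← C.mate-unique (C.mate-spec i) (C.above p)
      with subst (Reads φ (h j)) (proj₁ p) (reads j)
    ... | down q _ = trans (turn-∈ q) (trans (cong M.mate (φ-mate i)) (M.mate-mate (h i)))

    -- On both sides `next` is the tour after a turn, and φ respects turns and tours.
    φ-next : ∀ i → M.next ⟨$⟩ʳ (h i) ≡ h (C.next ⟨$⟩ʳ i)
    φ-next i = begin
      M.next ⟨$⟩ʳ (h i)                     ≡⟨ cong (M.next ⟨$⟩ʳ_) (turn-turn′ (C.turn-spec i)) ⟨
      M.next ⟨$⟩ʳ (turnʳ (h (C.turn i)))    ≡⟨ φ-tour (C.turn i) ⟨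
      h (shiftʳ (C.turn i))                 ∎
      where open ≡-Reasoning

    root≡ : ∀ f → M.first ≡ Maybe.map h f → (f ≡ nothing → ¬ Fin (2 * n)) → M.root ≡ C.rootAt f
    root≡ (just i) eq _ with M.first | M.isFirst
    root≡ (just i) refl _ | just _ | p = trans (sym p) (φ-end i)
    root≡ nothing eq empty = root-unique (empty refl)

    φ-root : M.root ≡ C.rootAt (firstPosition (2 * n))
    φ-root = root≡ (firstPosition (2 * n)) φ-first
      (λ eq i → case subst Fin (firstPosition-nothing (2 * n) eq) i of λ ())

    φ-tree : ∀ i → lookup M.tree (h i) ≡ isTree (letter i)
    φ-tree i with letter i | reads i
    ... | up _    | up p _ _ = Vec.[]=⇒lookup p
    ... | down    | down p _ = Vec.[]=⇒lookup p
    ... | chord _ | chord p _ with lookup M.tree (h i) in eq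
    ...   | inside  = contradiction (Vec.lookup⇒[]= (h i) M.tree eq) p
    ...   | outside = refl

module _ {n s} {letter : Fin (2 * n) → Letter (2 * n) s} (isCode : IsCode letter) where
  private module C where
    open Contour isCode public
    open ContourMap {n} isCode public
  open Reading C.treeRootedMap
  open Tour C.treeRootedMap (fromℕ∈vertexSet (labels letter))

  private
    stack-walk : ∀ i → IsWalk (fromℕ s) (C.end i) (C.stack i)
    stack-walk i = go (C.stack i) i refl
      where
      go : ∀ S i → C.stack i ≡ S → IsWalk (fromℕ s) (C.end i) S
      go [] i eq = subst (λ S → IsWalk (fromℕ s) (vertex letter S) []) (sym eq) []
      go (j ∷ S) i eq with u ← C.top⇒up eq = cons (C.tree-up (proj₂ u))
        (cong (vertex letter) (trans (C.top⇒stack eq) (sym eq)))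
        (go S (C.mate j) (List.∷-injectiveʳ (trans (sym (C.stack-mate-up u)) (C.top⇒stack eq))))

    stack-reduced : ∀ i → Reduced (C.stack i)
    stack-reduced i = go (C.stack i) i refl
      where
      go : ∀ S i → C.stack i ≡ S → Reduced S
      go [] i eq = tt
      go (j ∷ S) i eq with u ← C.top⇒up eq = noReturn S rest , go S (C.mate j) rest
        where
        rest = List.∷-injectiveʳ (trans (sym (C.stack-mate-up u)) (C.top⇒stack eq))
        noReturn : ∀ S → C.stack (C.mate j) ≡ S → NoReturn j S
        noReturn []      _  = tt
        -- Backtracking would make the mate of the `up` half-edge j `up` as well, but it is `down`.
        noReturn (g ∷ S) eq′ refl = case trans (sym (proj₁ (C.mate-up u))) (proj₂ (C.top⇒up eq′)) of λ ()

    path≡stack : ∀ i → path i ≡ C.stack i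
    path≡stack i = path-unique (stack-walk i) (stack-reduced i)

    isUp⁺ : ∀ {i} → C.IsUp i → IsUp i
    isUp⁺ {i} u = trans (path≡stack i) (trans (C.stack-mate-up u) (cong (i ∷_) (sym (path≡stack (C.mate i)))))

    turn≡ : ∀ {i j} → C.Turn i j → turnʳ i ≡ j
    turn≡ (C.stay eq) = turn-∉ (C.chord∉tree eq)
    turn≡ (C.below p) = trans (turn-∈ (C.tree-down (proj₁ p))) (C.mate-unique (C.mate-spec _) (C.below p))
    turn≡ (C.above p) = trans (turn-∈ (C.tree-up (proj₂ (C.pops⇒up p)))) (C.mate-unique (C.mate-spec _) (C.above p))

    reads : ∀ i → Reads Perm.id i (letter i)
    reads i with letter i in eq
    ... | chord j = chord (C.chord∉tree eq) (sym (C.mate-unique (C.mate-spec i) (C.across eq)))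
    ... | up c    = up (C.tree-up eq) (isUp⁺ (c , eq)) (C.end-up eq)
    ... | down    = down (C.tree-down eq) (isUp⁺ (C.pops⇒up (C.mate-down eq)))

    shift≡τ : ∀ i → shiftʳ i ≡ τ i
    shift≡τ i = trans (cong shiftʳ (sym (C.turn-turn i))) (cong (C.next ⟨$⟩ʳ_) (sym (turn≡ (C.turn-spec i))))

  -- The stacks of the code are reduced walks to s + 1, hence the tree paths. So the orientations
  -- and turns agree, and positions in the word already are positions in the tour.
  contourMap-realizes : Realizes letter
  contourMap-realizes = record
    { φ = Perm.id ; φ-first = sym (map-id _) ; φ-tour = shift≡τ ; reads = reads }

module _ {n s} {V V′ : Subset s} {M : TreeRootedMap n (vertexSet V)} {M′ : TreeRootedMap n (vertexSet V′)}
         (iso : Iso M M′) where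
  private
    module M where
      open Reading M public
      open Tour M (fromℕ∈vertexSet V) public
      open TreeRootedMap M public
    module M′ where
      open Reading M′ public
      open Tour M′ (fromℕ∈vertexSet V′) public
      open TreeRootedMap M′ public
    open Iso iso renaming (φ to π)

    g : Fin (2 * n) → Fin (2 * n)
    g = π ⟨$⟩ʳ_

    ∈⁺ : ∀ {h} → h ∈ M.tree → g h ∈ M′.tree
    ∈⁺ {h} p = Vec.lookup⇒[]= (g h) M′.tree (trans (φ-tree h) (Vec.[]=⇒lookup p))

    ∈⁻ : ∀ {h} → g h ∈ M′.tree → h ∈ M.tree
    ∈⁻ {h} p = Vec.lookup⇒[]= h M.tree (trans (sym (φ-tree h)) (Vec.[]=⇒lookup p))

    walk : ∀ {u v w} → M.IsWalk v u w → M′.IsWalk v u (List.map g w)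
    walk M.[] = M′.[]
    walk (M.cons {h = h} {w} p eq walk₁) = M′.cons (∈⁺ p) (trans (φ-end h) eq)
      (subst (λ x → M′.IsWalk _ x (List.map g w)) (sym (trans (cong M′.end (φ-mate h)) (φ-end (M.mate h)))) (walk walk₁))

    reduced : ∀ {w} → M.Reduced w → M′.Reduced (List.map g w)
    reduced {[]} _ = tt
    reduced {h ∷ w} (p , r) = noReturn w p , reduced r
      where
      noReturn : ∀ w → M.NoReturn h w → M′.NoReturn (g h) (List.map g w)
      noReturn []      _ = tt
      noReturn (f ∷ w) p eq = p (permutation-injective π (trans eq (φ-mate h)))

    path≡ : ∀ h → M′.path (g h) ≡ List.map g (M.path h)
    path≡ h = M′.path-unique (subst (λ x → M′.IsWalk _ x (List.map g (M.path h))) (sym (φ-end h)) (walk (M.path-walk h)))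
      (reduced (M.path-reduced h))

    isUp⁺ : ∀ {h} → M.IsUp h → M′.IsUp (g h)
    isUp⁺ {h} u = trans (path≡ h) (trans (cong (List.map g) u)
      (cong (g h ∷_) (sym (trans (cong M′.path (φ-mate h)) (path≡ (M.mate h))))))

    turn≡ : ∀ h → M′.turnʳ (g h) ≡ g (M.turnʳ h)
    turn≡ h with M.tree? h
    ... | yes p = trans (M′.turn-∈ (∈⁺ p)) (φ-mate h)
    ... | no ¬p = M′.turn-∉ (¬p ∘ ∈⁻)

    tour≡ : ∀ h → g (M.τ h) ≡ M′.τ (g h)
    tour≡ h = trans (sym (φ-next (M.turnʳ h))) (cong (M′.next ⟨$⟩ʳ_) (sym (turn≡ h)))

    reads : ∀ {φ φ′ h l} → (∀ i → φ′ ⟨$⟩ʳ i ≡ g (φ ⟨$⟩ʳ i)) → M.Reads φ h l → M′.Reads φ′ (g h) l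
    reads {h = h} conj (M.chord {j} p q) = M′.chord (p ∘ ∈⁻) (trans (conj j) (trans (cong g q) (sym (φ-mate h))))
    reads {h = h} conj (M.up p u eq) = M′.up (∈⁺ p) (isUp⁺ u) (trans (φ-end h) eq)
    reads {h = h} conj (M.down p u) = M′.down (∈⁺ p) (subst M′.IsUp (sym (φ-mate h)) (isUp⁺ u))

  -- An isomorphism preserves the first half-edge and commutes with the tours, so it matches
  -- half-edges at equal positions, and what is read there is invariant.
  iso⇒letters : ∀ {letter letter′} → M.Realizes letter → M′.Realizes letter′ → ∀ i → letter i ≡ letter′ i
  iso⇒letters {letter} {letter′} r r′ i = M′.reads-unique {R′.φ}
    (subst (λ x → M′.Reads R′.φ x (letter i)) (sym (conj i)) (reads conj (R.reads i))) (R′.reads i)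
    where
    module R  = M.Realizes r
    module R′ = M′.Realizes r′
    conj : ∀ i → R′.φ ⟨$⟩ʳ i ≡ g (R.φ ⟨$⟩ʳ i)
    conj i = fromFirst {t = M′.τ} R′.φ-tour
      (λ i → trans (cong g (R.φ-tour i)) (tour≡ (R.φ ⟨$⟩ʳ i)))
      (trans (sym R′.φ-first) (trans φ-first (trans (cong (Maybe.map g) R.φ-first) (sym (map-∘ (firstPosition (2 * n))))))) i
      where
      fromFirst : ∀ {m} {A : Set} {f f′ : Fin m → A} {t : A → A} →
        (∀ i → f (shiftʳ i) ≡ t (f i)) → (∀ i → f′ (shiftʳ i) ≡ t (f′ i)) →
        Maybe.map f (firstPosition m) ≡ Maybe.map f′ (firstPosition m) → ∀ i → f i ≡ f′ i
      fromFirst {suc m} {f = f} {f′} {t} p p′ eq i = begin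
        f i                                ≡⟨ cong f (shift-iterate i) ⟨
        f (iterate shiftʳ zero (toℕ i))    ≡⟨ iterate-conj f p zero (toℕ i) ⟩
        iterate t (f zero) (toℕ i)         ≡⟨ cong (λ x → iterate t x (toℕ i)) (just-injective eq) ⟩
        iterate t (f′ zero) (toℕ i)        ≡⟨ iterate-conj f′ p′ zero (toℕ i) ⟨
        f′ (iterate shiftʳ zero (toℕ i))   ≡⟨ cong f′ (shift-iterate i) ⟩
        f′ i                               ∎
        where open ≡-Reasoning

-- Boundary paths of boards.

-- A lattice path with a row steps and b column steps, l steps in total: the
-- boundary of a board, read so that column j meets row i exactly if the step
-- of column j comes before that of row i.
data Steps : ℕ → ℕ → ℕ → Set where
  []  : Steps 0 0 0
  row : ∀ {a b l} → Steps a b l → Steps (suc a) b (suc l)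
  col : ∀ {a b l} → Steps a b l → Steps a (suc b) (suc l)

pos : ∀ {a b l} → Steps a b l → Fin a ⊎ Fin b → Fin l
pos (row p) (inj₁ zero)    = zero
pos (row p) (inj₁ (suc i)) = suc (pos p (inj₁ i))
pos (row p) (inj₂ j)       = suc (pos p (inj₂ j))
pos (col p) (inj₁ i)       = suc (pos p (inj₁ i))
pos (col p) (inj₂ zero)    = zero
pos (col p) (inj₂ (suc j)) = suc (pos p (inj₂ j))

at : ∀ {a b l} → Steps a b l → Fin l → Fin a ⊎ Fin b
at (row p) zero    = inj₁ zero
at (row p) (suc x) = Sum⊎.map₁ suc (at p x)
at (col p) zero    = inj₂ zero
at (col p) (suc x) = Sum⊎.map₂ suc (at p x)

at-pos : ∀ {a b l} (p : Steps a b l) y → at p (pos p y) ≡ y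
at-pos (row p) (inj₁ zero)    = refl
at-pos (row p) (inj₁ (suc i)) = cong (Sum⊎.map₁ suc) (at-pos p (inj₁ i))
at-pos (row p) (inj₂ j)       = cong (Sum⊎.map₁ suc) (at-pos p (inj₂ j))
at-pos (col p) (inj₁ i)       = cong (Sum⊎.map₂ suc) (at-pos p (inj₁ i))
at-pos (col p) (inj₂ zero)    = refl
at-pos (col p) (inj₂ (suc j)) = cong (Sum⊎.map₂ suc) (at-pos p (inj₂ j))

pos-at : ∀ {a b l} (p : Steps a b l) x → pos p (at p x) ≡ x
pos-at (row p) zero    = refl
pos-at (row p) (suc x) with at p x | pos-at p x
... | inj₁ i | eq = cong suc eq
... | inj₂ j | eq = cong suc eq
pos-at (col p) zero    = refl
pos-at (col p) (suc x) with at p x | pos-at p x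
... | inj₁ i | eq = cong suc eq
... | inj₂ j | eq = cong suc eq

pos-injective : ∀ {a b l} (p : Steps a b l) {y y′} → pos p y ≡ pos p y′ → y ≡ y′
pos-injective p eq = trans (sym (at-pos p _)) (trans (cong (at p) eq) (at-pos p _))

-- The length of row i inside the extra columns.
height : ∀ {a b l} → Steps a b l → Fin a → ℕ
height (row p) zero    = 0
height (row p) (suc i) = height p i
height (col p) i       = suc (height p i)

height-≤ : ∀ {a b l} (p : Steps a b l) i → height p i ≤ b
height-≤ (row p) zero    = z≤n
height-≤ (row p) (suc i) = height-≤ p i
height-≤ (col p) i       = s≤s (height-≤ p i)

height-monotone : ∀ {a b l} (p : Steps a b l) i i′ → i Fin.≤ i′ → height p i ≤ height p i′
height-monotone (row p) zero    i′       _         = z≤n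
height-monotone (row p) (suc i) (suc i′) (s≤s i≤i′) = height-monotone p i i′ i≤i′
height-monotone (col p) i       i′       i≤i′      = s≤s (height-monotone p i i′ i≤i′)

<height⇒before : ∀ {a b l} (p : Steps a b l) {i j} → toℕ j < height p i → pos p (inj₂ j) Fin.< pos p (inj₁ i)
<height⇒before (row p) {suc i} {j}     lt       = s≤s (<height⇒before p lt)
<height⇒before (col p) {i}     {zero}  _        = s≤s z≤n
<height⇒before (col p) {i}     {suc j} (s≤s lt) = s≤s (<height⇒before p lt)

before⇒<height : ∀ {a b l} (p : Steps a b l) {i j} → pos p (inj₂ j) Fin.< pos p (inj₁ i) → toℕ j < height p i
before⇒<height (row p) {suc i} {j}     (s≤s lt) = before⇒<height p lt
before⇒<height (col p) {i}     {zero}  _        = s≤s z≤n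
before⇒<height (col p) {i}     {suc j} (s≤s lt) = s≤s (before⇒<height p lt)

-- A first row of height 0 forces a row step. Otherwise all heights are positive by monotonicity,
-- and a column step lowers them all by one.
fromHeights : ∀ a b {l} → a + b ≡ l → (h : Fin a → ℕ) → (∀ i i′ → i Fin.≤ i′ → h i ≤ h i′) → (∀ i → h i ≤ b) →
              Σ (Steps a b l) λ p → ∀ i → height p i ≡ h i
fromHeights zero    zero    refl h mono ≤b = [] , λ ()
fromHeights zero    (suc b) refl h mono ≤b with p , _ ← fromHeights zero b refl h mono (λ ()) = col p , λ ()
fromHeights (suc a) b       eq   h mono ≤b with h zero in h₀
fromHeights (suc a) b refl h mono ≤b | zero
  with p , q ← fromHeights a b refl (h ∘ suc) (λ i i′ le → mono (suc i) (suc i′) (s≤s le)) (≤b ∘ suc) =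
  row p , λ where
    zero    → sym h₀
    (suc i) → q i
fromHeights (suc a) zero    eq   h mono ≤b | suc k = contradiction (≤b zero) (ℕ.<⇒≱ (subst (0 <_) (sym h₀) (s≤s z≤n)))
fromHeights (suc a) (suc b) refl h mono ≤b | suc k
  with p , q ← fromHeights (suc a) b (sym (ℕ.+-suc a b)) (pred ∘ h)
                 (λ i i′ le → ℕ.pred-mono-≤ (mono i i′ le)) (λ i → ℕ.pred-mono-≤ (≤b i)) =
  col p , λ i → trans (cong suc (q i))
    (ℕ.suc-pred (h i) {{>-nonZero (ℕ.<-≤-trans (subst (0 <_) (sym h₀) (s≤s z≤n)) (mono zero i z≤n))}})

height-injective : ∀ {a b l} (p q : Steps a b l) → (∀ i → height p i ≡ height q i) → p ≡ q
height-injective []      []      eq = refl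
height-injective (row p) (row q) eq = cong row (height-injective p q (eq ∘ suc))
height-injective (col p) (col q) eq = cong col (height-injective p q (ℕ.suc-injective ∘ eq))
height-injective (row p) (col q) eq = case eq zero of λ ()
height-injective (col p) (row q) eq = case eq zero of λ ()

isRow : ∀ {A B : Set} → A ⊎ B → Bool
isRow (inj₁ _) = true
isRow (inj₂ _) = false

isRow-map₁ : ∀ {A B C : Set} {f : A → C} (y : A ⊎ B) → isRow (Sum⊎.map₁ f y) ≡ isRow y
isRow-map₁ (inj₁ _) = refl
isRow-map₁ (inj₂ _) = refl

isRow-map₂ : ∀ {A B C : Set} {f : B → C} (y : A ⊎ B) → isRow (Sum⊎.map₂ f y) ≡ isRow y
isRow-map₂ (inj₁ _) = refl
isRow-map₂ (inj₂ _) = refl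

isRow-injective : ∀ {a b l} (p q : Steps a b l) → (∀ x → isRow (at p x) ≡ isRow (at q x)) → p ≡ q
isRow-injective []      []      eq = refl
isRow-injective (row p) (row q) eq = cong row (isRow-injective p q
  λ x → trans (sym (isRow-map₁ (at p x))) (trans (eq (suc x)) (isRow-map₁ (at q x))))
isRow-injective (col p) (col q) eq = cong col (isRow-injective p q
  λ x → trans (sym (isRow-map₂ (at p x))) (trans (eq (suc x)) (isRow-map₂ (at q x))))
isRow-injective (row p) (col q) eq = case eq zero of λ ()
isRow-injective (col p) (row q) eq = case eq zero of λ ()

indicator : Bool → ℕ
indicator true  = 1
indicator false = 0

∑-rows : ∀ {a b l} (p : Steps a b l) → ∑ (indicator ∘ isRow ∘ at p) ≡ a
∑-rows []      = refl
∑-rows (row p) = cong suc (trans (∑-cong λ x → cong indicator (isRow-map₁ (at p x))) (∑-rows p))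
∑-rows (col p) = trans (∑-cong λ x → cong indicator (isRow-map₂ (at p x))) (∑-rows p)

∑-cols : ∀ {a b l} (p : Steps a b l) → ∑ (indicator ∘ not ∘ isRow ∘ at p) ≡ b
∑-cols []      = refl
∑-cols (row p) = trans (∑-cong λ x → cong (indicator ∘ not) (isRow-map₁ (at p x))) (∑-cols p)
∑-cols (col p) = cong suc (trans (∑-cong λ x → cong (indicator ∘ not) (isRow-map₂ (at p x))) (∑-cols p))

-- The numbers of row and column steps are known only as sums here; for a code, balance shows both
-- to be n.
fromRows : ∀ {l} (r : Fin l → Bool) →
           Σ (Steps (∑ (indicator ∘ r)) (∑ (indicator ∘ not ∘ r)) l) λ p → ∀ x → isRow (at p x) ≡ r x
fromRows {zero}  r = [] , λ ()
fromRows {suc l} r with p , q ← fromRows (r ∘ suc) with r zero in r₀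
... | true  = row p , λ where
  zero    → sym r₀
  (suc x) → trans (isRow-map₁ (at p x)) (q x)
... | false = col p , λ where
  zero    → sym r₀
  (suc x) → trans (isRow-map₂ (at p x)) (q x)

steps-length : ∀ {a b l} → Steps a b l → a + b ≡ l
steps-length []      = refl
steps-length (row p) = cong suc (steps-length p)
steps-length {a} {suc b} (col p) = trans (ℕ.+-suc a b) (cong suc (steps-length p))

-- Rook placements as codes.

chordRow chordCol : ∀ {m s} → Letter m s → Bool → ℕ
chordRow (chord _) b = indicator b
chordRow _         b = 0
chordCol (chord _) b = indicator (not b)
chordCol _         b = 0

not-not : ∀ b → not (not b) ≡ b
not-not true  = refl
not-not false = refl

module _ {m s} (letter : Fin m → Letter m s) (r : Fin m → Bool)
         (chord-sym : ∀ {i j} → letter i ≡ chord j → letter j ≡ chord i)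
         (up-row    : ∀ {i c} → letter i ≡ up c → r i ≡ true)
         (down-col  : ∀ {i} → letter i ≡ down → r i ≡ false)
         (chord-swap : ∀ {i j} → letter i ≡ chord j → r j ≡ not (r i)) where

  private
    partner : Fin m → Fin m
    partner i with letter i
    ... | chord j = j
    ... | _       = i

    partner-partner : ∀ i → partner (partner i) ≡ i
    partner-partner i with letter i in eq
    ... | chord j rewrite chord-sym eq = refl
    ... | up _    rewrite eq = refl
    ... | down    rewrite eq = refl

    row-swap : ∀ i → chordRow (letter i) (r i) ≡ chordCol (letter (partner i)) (r (partner i))
    row-swap i with letter i in eq
    ... | up _    rewrite eq = refl
    ... | down    rewrite eq = refl
    ... | chord j rewrite chord-sym eq | chord-swap eq = cong indicator (sym (not-not (r i)))

    row-split : ∀ i → indicator (r i) ≡ isUp (letter i) + chordRow (letter i) (r i)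
    row-split i with letter i in eq
    ... | chord _ = refl
    ... | up _    = cong indicator (up-row eq)
    ... | down    = cong indicator (down-col eq)

    col-split : ∀ i → indicator (not (r i)) ≡ isDown (letter i) + chordCol (letter i) (r i)
    col-split i with letter i in eq
    ... | chord _ = refl
    ... | up _    = cong (indicator ∘ not) (up-row eq)
    ... | down    = cong (indicator ∘ not) (down-col eq)

  -- Rows are `up` letters and row sides of chords, columns are `down` letters and column sides of
  -- chords, and exchanging the sides of chords equates the latter counts. It serves in both
  -- directions: n rows and n columns give `balanced`, and `balanced` gives equally many rows and
  -- columns.
  row-balance : ∑ (indicator ∘ r) + ∑ (isDown ∘ letter) ≡ ∑ (indicator ∘ not ∘ r) + ∑ (isUp ∘ letter)
  row-balance = begin
    ∑ (indicator ∘ r) + D                  ≡⟨ cong (_+ D) (trans (∑-cong row-split) (∑-distrib-+ (isUp ∘ letter) rows)) ⟩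
    (U + ∑ rows) + D                       ≡⟨ cong (λ x → (U + x) + D) (trans (∑-cong row-swap)
                                                (sym (sum-permute cols (Perm.permutation partner partner partner-partner partner-partner)))) ⟩
    (U + ∑ cols) + D                       ≡⟨ ℕ.+-comm (U + ∑ cols) D ⟩
    D + (U + ∑ cols)                       ≡⟨ cong (D +_) (ℕ.+-comm U (∑ cols)) ⟩
    D + (∑ cols + U)                       ≡⟨ ℕ.+-assoc D (∑ cols) U ⟨
    (D + ∑ cols) + U                       ≡⟨ cong (_+ U) (trans (∑-cong col-split) (∑-distrib-+ (isDown ∘ letter) cols)) ⟨
    ∑ (indicator ∘ not ∘ r) + U            ∎
    where
    open ≡-Reasoning
    U = ∑ (isUp ∘ letter)
    D = ∑ (isDown ∘ letter)
    rows cols : Fin m → ℕ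
    rows i = chordRow (letter i) (r i)
    cols i = chordCol (letter i) (r i)

chord-injective : ∀ {m s} {x y : Fin m} → chord {s = s} x ≡ chord y → x ≡ y
chord-injective refl = refl

-- A rook lies on the board exactly when its column step precedes its row step, so the later side of
-- a chord is the row.
rowLetter : ∀ {m s} → Fin m → Letter m s → Bool
rowLetter x (chord y) = does (y Fin.<? x)
rowLetter x (up _)    = true
rowLetter x down      = false

module _ {m} {x y : Fin m} where

  <?-true : x Fin.< y → does (x Fin.<? y) ≡ true
  <?-true = dec-true (x Fin.<? y)

  <?-false : ¬ x Fin.< y → does (x Fin.<? y) ≡ false
  <?-false = dec-false (x Fin.<? y)

-- A board, given by its boundary path, and for each row the column of its
-- rook: inj₁ c for the first s columns and inj₂ j for the column s + j.
record Placement (n s : ℕ) : Set where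
  field
    steps            : Steps n n (2 * n)
    column           : Fin n → Fin s ⊎ Fin n
    column-injective : Injective _≡_ _≡_ column
    column-before    : ∀ {i j} → column i ≡ inj₂ j → pos steps (inj₂ j) Fin.< pos steps (inj₁ i)

  data Placed : Fin n ⊎ Fin n → Letter (2 * n) s → Set where
    row-up    : ∀ {i c} → column i ≡ inj₁ c → Placed (inj₁ i) (up c)
    row-chord : ∀ {i j} → column i ≡ inj₂ j → Placed (inj₁ i) (chord (pos steps (inj₂ j)))
    col-chord : ∀ {i j} → column i ≡ inj₂ j → Placed (inj₂ j) (chord (pos steps (inj₁ i)))
    col-down  : ∀ {j} → (∀ i → column i ≢ inj₂ j) → Placed (inj₂ j) down

  placed-exists : ∀ y → ∃[ l ] Placed y l
  placed-exists (inj₁ i) with column i in eq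
  ... | inj₁ c = _ , row-up eq
  ... | inj₂ j = _ , row-chord eq
  placed-exists (inj₂ j) with Fin.any? (λ i → ≡-dec Fin._≟_ Fin._≟_ (column i) (inj₂ j))
  ... | yes (i , eq) = _ , col-chord eq
  ... | no ¬p        = _ , col-down (λ i eq → ¬p (i , eq))

  placed-unique : ∀ {y l l′} → Placed y l → Placed y l′ → l ≡ l′
  placed-unique (row-up p)    (row-up q)    = cong up (inj₁-injective (trans (sym p) q))
  placed-unique (row-up p)    (row-chord q) = case trans (sym p) q of λ ()
  placed-unique (row-chord p) (row-up q)    = case trans (sym p) q of λ ()
  placed-unique (row-chord p) (row-chord q) = cong (λ j → chord (pos steps (inj₂ j))) (inj₂-injective (trans (sym p) q))
  placed-unique (col-chord p) (col-chord q) = cong (λ i → chord (pos steps (inj₁ i))) (column-injective (trans p (sym q)))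
  placed-unique (col-chord p) (col-down q)  = contradiction p (q _)
  placed-unique (col-down q)  (col-chord p) = contradiction p (q _)
  placed-unique (col-down _)  (col-down _)  = refl

  letter : Fin (2 * n) → Letter (2 * n) s
  letter x = proj₁ (placed-exists (at steps x))

  placed : ∀ x → Placed (at steps x) (letter x)
  placed x = proj₂ (placed-exists (at steps x))

  letter-placed : ∀ {y l} → Placed y l → letter (pos steps y) ≡ l
  letter-placed {y} p = placed-unique (placed (pos steps y)) (subst (λ z → Placed z _) (sym (at-pos steps y)) p)

  placed-letter : ∀ {x l} → letter x ≡ l → Placed (at steps x) l
  placed-letter {x} eq = subst (Placed (at steps x)) eq (placed x)

  private
    at⇒pos : ∀ {x y} → at steps x ≡ y → pos steps y ≡ x
    at⇒pos {x} eq = trans (cong (pos steps) (sym eq)) (pos-at steps x)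

  -- This makes the board recoverable from the word: the kind of each step depends on its position
  -- and letter alone.
  row? : ∀ x → isRow (at steps x) ≡ rowLetter x (letter x)
  row? x with at steps x in eq | letter x | placed x
  ... | inj₁ i | up c    | row-up _ = refl
  ... | inj₁ i | chord y | row-chord p = sym (<?-true (subst (pos steps (inj₂ _) Fin.<_) (at⇒pos eq) (column-before p)))
  ... | inj₂ j | chord y | col-chord p = sym (<?-false
    λ lt → ℕ.<-asym lt (subst (Fin._< pos steps (inj₁ _)) (at⇒pos eq) (column-before p)))
  ... | inj₂ j | down    | col-down _ = refl

  letter-sym : ∀ {x y} → letter x ≡ chord y → letter y ≡ chord x
  letter-sym {x} eq with at steps x in eq′ | placed-letter {x} eq
  ... | inj₁ i | row-chord p = trans (letter-placed (col-chord p)) (cong chord (at⇒pos eq′))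
  ... | inj₂ j | col-chord p = trans (letter-placed (row-chord p)) (cong chord (at⇒pos eq′))

  letter-swap : ∀ {x y} → letter x ≡ chord y → isRow (at steps y) ≡ not (isRow (at steps x))
  letter-swap {x} eq with at steps x | placed-letter {x} eq
  ... | inj₁ i | row-chord {j = j} p = cong isRow (at-pos steps (inj₂ j))
  ... | inj₂ j | col-chord {i} p     = cong isRow (at-pos steps (inj₁ i))

  isCode : IsCode letter
  isCode = record
    { chord-sym    = letter-sym
    ; chord-irrefl = λ {x} eq → not-fixed (isRow (at steps x)) (letter-swap eq)
    ; up-injective = λ {x} {y} p q → up-inj (placed-letter p) (placed-letter q)
    ; balanced     = sym (ℕ.+-cancelˡ-≡ n _ _ (begin
        n + ∑ (isDown ∘ letter)                                      ≡⟨ cong (_+ ∑ (isDown ∘ letter)) (∑-rows steps) ⟨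
        ∑ (indicator ∘ isRow ∘ at steps) + ∑ (isDown ∘ letter)       ≡⟨ row-balance letter (isRow ∘ at steps) letter-sym
                                                                          (λ {x} eq → trans (row? x) (cong (rowLetter x) eq))
                                                                          (λ {x} eq → trans (row? x) (cong (rowLetter x) eq))
                                                                          letter-swap ⟩
        ∑ (indicator ∘ not ∘ isRow ∘ at steps) + ∑ (isUp ∘ letter)   ≡⟨ cong (_+ ∑ (isUp ∘ letter)) (∑-cols steps) ⟩
        n + ∑ (isUp ∘ letter)                                        ∎))
    }
    where
    open ≡-Reasoning
    not-fixed : ∀ b → b ≢ not b
    not-fixed true  ()
    not-fixed false ()
    up-inj : ∀ {x y c} → Placed (at steps x) (up c) → Placed (at steps y) (up c) → x ≡ y
    up-inj {x} {y} p q = go (at steps x) (at steps y) refl refl p q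
      where
      go : ∀ u v {c} → at steps x ≡ u → at steps y ≡ v → Placed u (up c) → Placed v (up c) → x ≡ y
      go (inj₁ i) (inj₁ i′) e e′ (row-up p) (row-up q) = trans (sym (at⇒pos e))
        (trans (cong (pos steps ∘ inj₁) (column-injective (trans p (sym q)))) (at⇒pos e′))

module _ {n s} (P Q : Placement n s) where
  private
    module P = Placement P
    module Q = Placement Q

  letters⇒steps : (∀ x → P.letter x ≡ Q.letter x) → P.steps ≡ Q.steps
  letters⇒steps eq = isRow-injective P.steps Q.steps
    λ x → trans (P.row? x) (trans (cong (rowLetter x) (eq x)) (sym (Q.row? x)))

  letters⇒column : (∀ x → P.letter x ≡ Q.letter x) → ∀ i → P.column i ≡ Q.column i
  letters⇒column eq i = go (proj₂ (P.placed-exists (inj₁ i))) (proj₂ (Q.placed-exists (inj₁ i))) (begin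
      _                                  ≡⟨ P.letter-placed (proj₂ (P.placed-exists (inj₁ i))) ⟨
      P.letter (pos P.steps (inj₁ i))    ≡⟨ eq (pos P.steps (inj₁ i)) ⟩
      Q.letter (pos P.steps (inj₁ i))    ≡⟨ cong (λ p → Q.letter (pos p (inj₁ i))) same ⟩
      Q.letter (pos Q.steps (inj₁ i))    ≡⟨ Q.letter-placed (proj₂ (Q.placed-exists (inj₁ i))) ⟩
      _                                  ∎)
    where
    open ≡-Reasoning
    same = letters⇒steps eq
    go : ∀ {l l′} → P.Placed (inj₁ i) l → Q.Placed (inj₁ i) l′ → l ≡ l′ → P.column i ≡ Q.column i
    go (P.row-up p)    (Q.row-up q)    refl = trans p (sym q)
    go (P.row-chord p) (Q.row-chord q) e = trans p (trans (cong inj₂ j≡k) (sym q))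
      where
      j≡k = inj₂-injective (pos-injective Q.steps (trans (cong (λ p → pos p (inj₂ _)) (sym same)) (chord-injective e)))

  columns⇒letters : P.steps ≡ Q.steps → (∀ i → P.column i ≡ Q.column i) → ∀ x → P.letter x ≡ Q.letter x
  columns⇒letters e c x = Q.placed-unique
    (subst (λ p → Q.Placed (at p x) (P.letter x)) e (go (P.placed x))) (Q.placed x)
    where
    go : ∀ {y l} → P.Placed y l → Q.Placed y l
    go (P.row-up {i} p)        = Q.row-up (trans (sym (c i)) p)
    go (P.row-chord {i} {j} p) = subst (λ p → Q.Placed (inj₁ i) (chord (pos p (inj₂ j)))) (sym e) (Q.row-chord (trans (sym (c i)) p))
    go (P.col-chord {i} {j} p) = subst (λ p → Q.Placed (inj₂ j) (chord (pos p (inj₁ i)))) (sym e) (Q.col-chord (trans (sym (c i)) p))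
    go (P.col-down p)          = Q.col-down (λ i q → p i (trans (c i) q))

module _ {n s} {letter : Fin (2 * n) → Letter (2 * n) s} (isCode : IsCode letter) where
  open IsCode isCode

  private
    r : Fin (2 * n) → Bool
    r x = rowLetter x (letter x)

    r-swap : ∀ {x y} → letter x ≡ chord y → r y ≡ not (r x)
    r-swap {x} {y} eq rewrite eq | chord-sym eq with ℕ.<-cmp (toℕ x) (toℕ y)
    ... | tri< lt _ ¬gt = trans (<?-true lt) (cong not (sym (<?-false ¬gt)))
    ... | tri> ¬lt _ gt = trans (<?-false ¬lt) (cong not (sym (<?-true gt)))
    ... | tri≈ _ x≡y _  = contradiction (subst (λ z → letter x ≡ chord z) (sym (Fin.toℕ-injective x≡y)) eq) chord-irrefl

    rows cols : ℕ
    rows = ∑ (indicator ∘ r)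
    cols = ∑ (indicator ∘ not ∘ r)

    rows≡cols : rows ≡ cols
    rows≡cols = ℕ.+-cancelʳ-≡ (∑ (isUp ∘ letter)) _ _ (trans (cong (rows +_) balanced)
      (row-balance letter r chord-sym (λ {x} → cong (rowLetter x)) (λ {x} → cong (rowLetter x)) r-swap))

    half : ∀ {a b} → a ≡ b → a + b ≡ 2 * n → a ≡ n
    half {a} refl eq = ℕ.*-cancelˡ-≡ a n 2 (trans (cong (a +_) (ℕ.+-identityʳ a)) eq)

    letterSteps : Σ (Steps n n (2 * n)) λ p → ∀ x → isRow (at p x) ≡ r x
    letterSteps with p , q ← fromRows r
      -- The path is indexed by the two sums; abstracting them together with the equations turns
      -- both indices into n.
      with rows | cols | rows≡cols | half rows≡cols (steps-length p) | p | q
    ... | _ | _ | refl | refl | p | q = p , q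

    steps = proj₁ letterSteps
    steps-row = proj₂ letterSteps

    data Column (i : Fin n) : Fin s ⊎ Fin n → Set where
      first : ∀ {c} → letter (pos steps (inj₁ i)) ≡ up c → Column i (inj₁ c)
      extra : ∀ {j} → letter (pos steps (inj₁ i)) ≡ chord (pos steps (inj₂ j)) → Column i (inj₂ j)

    r-row : ∀ i → r (pos steps (inj₁ i)) ≡ true
    r-row i = trans (sym (steps-row _)) (cong isRow (at-pos steps (inj₁ i)))

    r-col : ∀ j → r (pos steps (inj₂ j)) ≡ false
    r-col j = trans (sym (steps-row _)) (cong isRow (at-pos steps (inj₂ j)))

    isRow-false : ∀ {A B : Set} (y : A ⊎ B) → isRow y ≡ false → ∃[ j ] y ≡ inj₂ j
    isRow-false (inj₂ j) _ = j , refl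

    isRow-true : ∀ {A B : Set} (y : A ⊎ B) → isRow y ≡ true → ∃[ i ] y ≡ inj₁ i
    isRow-true (inj₁ i) _ = i , refl

    column-exists : ∀ i → ∃[ y ] Column i y
    column-exists i with letter (pos steps (inj₁ i)) in eq
    ... | up c = inj₁ c , first eq
    ... | down = case trans (sym (r-row i)) (cong (rowLetter _) eq) of λ ()
    ... | chord x with j , p ← isRow-false (at steps x)
                         (trans (steps-row x) (trans (r-swap eq) (cong not (r-row i)))) =
      inj₂ j , extra (trans eq (cong chord (trans (sym (pos-at steps x)) (cong (pos steps) p))))

    column : Fin n → Fin s ⊎ Fin n
    column i = proj₁ (column-exists i)

    column-spec : ∀ i → Column i (column i)
    column-spec i = proj₂ (column-exists i)

    column-at : ∀ {i y} → column i ≡ y → Column i y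
    column-at {i} eq = subst (Column i) eq (column-spec i)

    column-unique : ∀ {i y y′} → Column i y → Column i y′ → y ≡ y′
    column-unique (first p) (first q) = case trans (sym p) q of λ where refl → refl
    column-unique (first p) (extra q) = case trans (sym p) q of λ ()
    column-unique (extra p) (first q) = case trans (sym p) q of λ ()
    column-unique (extra p) (extra q) = cong inj₂ (inj₂-injective (pos-injective steps (chord-injective (trans (sym p) q))))

    columns-distinct : ∀ {i i′ y} → Column i y → Column i′ y → i ≡ i′
    columns-distinct (first p) (first q) = inj₁-injective (pos-injective steps (up-injective p q))
    columns-distinct (extra p) (extra q) = case trans (sym (chord-sym p)) (chord-sym q) of
      λ eq → inj₁-injective (pos-injective steps (chord-injective eq))

    column-before : ∀ {i j} → Column i (inj₂ j) → pos steps (inj₂ j) Fin.< pos steps (inj₁ i)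
    column-before {i} {j} (extra p) = <?-true⁻ (trans (sym (cong (rowLetter _) p)) (r-row i))
      where
      <?-true⁻ : ∀ {m} {x y : Fin m} → does (x Fin.<? y) ≡ true → x Fin.< y
      <?-true⁻ {x = x} {y} eq with x Fin.<? y
      ... | yes lt = lt
      ... | no ¬lt = case trans (sym eq) (<?-false ¬lt) of λ ()

  code⇒placement : Placement n s
  code⇒placement = record
    { steps = steps ; column = column
    ; column-injective = λ {i} {i′} eq → columns-distinct (column-spec i) (subst (Column i′) (sym eq) (column-spec i′))
    ; column-before = λ eq → column-before (column-at eq) }

  private module P = Placement code⇒placement

  placement-letter : ∀ x → P.letter x ≡ letter x
  placement-letter x = P.placed-unique (P.placed x)
    (subst (λ z → P.Placed (at steps x) (letter z)) (pos-at steps x) (go (at steps x)))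
    where
    go : ∀ y → P.Placed y (letter (pos steps y))
    go (inj₁ i) with column i in eq | column-spec i
    ... | inj₁ c | first p = subst (P.Placed (inj₁ i)) (sym p) (P.row-up eq)
    ... | inj₂ j | extra p = subst (P.Placed (inj₁ i)) (sym p) (P.row-chord eq)
    go (inj₂ j) with letter (pos steps (inj₂ j)) in eq
    ... | up c = case trans (sym (r-col j)) (cong (rowLetter _) eq) of λ ()
    -- A rook in this column would, by symmetry of chords, make the letter a `chord`.
    ... | down = P.col-down λ i p → case column-at p of λ where
      (extra q) → case trans (sym eq) (chord-sym q) of λ ()
    ... | chord x with i , p ← isRow-true (at steps x)
                         (trans (steps-row x) (trans (r-swap eq) (cong not (r-col j)))) =
      subst (λ z → P.Placed (inj₂ j) (chord z)) x≡
        (P.col-chord (column-unique (column-spec i) (extra (trans (cong letter x≡) (chord-sym eq)))))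
      where x≡ = trans (cong (pos steps) (sym p)) (pos-at steps x)

-- Boards with sets of squares versus boundary paths with columns.

∣p∪q∣≡∣p∣+∣q∣ : ∀ {m} (p q : Subset m) → (∀ {x} → x ∈ p → x ∉ q) → ∣ p ∪ q ∣ ≡ ∣ p ∣ + ∣ q ∣
∣p∪q∣≡∣p∣+∣q∣ []            []            d = refl
∣p∪q∣≡∣p∣+∣q∣ (inside  ∷ p) (inside  ∷ q) d = contradiction Vec.here (d Vec.here)
∣p∪q∣≡∣p∣+∣q∣ (inside  ∷ p) (outside ∷ q) d = cong suc (∣p∪q∣≡∣p∣+∣q∣ p q λ a b → d (Vec.there a) (Vec.there b))
∣p∪q∣≡∣p∣+∣q∣ (outside ∷ p) (inside  ∷ q) d =
  trans (cong suc (∣p∪q∣≡∣p∣+∣q∣ p q λ a b → d (Vec.there a) (Vec.there b))) (sym (ℕ.+-suc ∣ p ∣ ∣ q ∣))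
∣p∪q∣≡∣p∣+∣q∣ (outside ∷ p) (outside ∷ q) d = ∣p∪q∣≡∣p∣+∣q∣ p q λ a b → d (Vec.there a) (Vec.there b)

-- Non-attacking rooks may be counted by their columns, and it is these that become labels.
occupied : ∀ {n m} → Squares n m → Subset m
occupied []      = Sub.⊥
occupied (p ∷ C) = p ∪ occupied C

∈-occupied⁺ : ∀ {n m x} (C : Squares n m) i → x ∈ lookup C i → x ∈ occupied C
∈-occupied⁺ (p ∷ C) zero    x∈ = Sub.x∈p∪q⁺ (inj₁ x∈)
∈-occupied⁺ (p ∷ C) (suc i) x∈ = Sub.x∈p∪q⁺ (inj₂ (∈-occupied⁺ C i x∈))

∈-occupied⁻ : ∀ {n m x} (C : Squares n m) → x ∈ occupied C → ∃[ i ] x ∈ lookup C i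
∈-occupied⁻ []      x∈ = contradiction x∈ Sub.∉⊥
∈-occupied⁻ (p ∷ C) x∈ with Sub.x∈p∪q⁻ p (occupied C) x∈
... | inj₁ x∈p = zero , x∈p
... | inj₂ x∈C with i , x∈ ← ∈-occupied⁻ C x∈C = suc i , x∈

∣occupied∣ : ∀ {n m} (C : Squares n m) → (∀ i i′ j → j ∈ lookup C i → j ∈ lookup C i′ → i ≡ i′) →
             ∣ occupied C ∣ ≡ ∥ C ∥
∣occupied∣ {m = m} [] _ = Sub.∣⊥∣≡0 m
∣occupied∣ (p ∷ C) colwise = trans
  (∣p∪q∣≡∣p∣+∣q∣ p (occupied C) λ x∈p x∈C → let i , x∈ = ∈-occupied⁻ C x∈C in
    case colwise zero (suc i) _ x∈p x∈ of λ ())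
  (cong (∣ p ∣ +_) (∣occupied∣ C λ i i′ j a b → Fin.suc-injective (colwise (suc i) (suc i′) j a b)))

lookup-take-↑ˡ : ∀ {A : Set} s {n} (v : Vec A (s + n)) i → lookup (take s v) i ≡ lookup v (i ↑ˡ n)
lookup-take-↑ˡ (suc s) (x ∷ v) zero    = refl
lookup-take-↑ˡ (suc s) (x ∷ v) (suc i) = lookup-take-↑ˡ s v i

sum-≤ : ∀ {n} (v : Vec ℕ n) → (∀ i → lookup v i ≤ 1) → Vec.sum v ≤ n
sum-≤ []      le = z≤n
sum-≤ (x ∷ v) le = ℕ.+-mono-≤ (le zero) (sum-≤ v (le ∘ suc))

-- If an entry were 0, the others could contribute at most n - 1.
sum-full : ∀ {n} (v : Vec ℕ n) → (∀ i → lookup v i ≤ 1) → Vec.sum v ≡ n → ∀ i → lookup v i ≢ 0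
sum-full (0 ∷ v)           le eq i       = contradiction (sum-≤ v (le ∘ suc)) (ℕ.<⇒≱ (ℕ.≤-reflexive (sym eq)))
sum-full (1 ∷ v)           le eq zero    = λ ()
sum-full (1 ∷ v)           le eq (suc i) = sum-full v (le ∘ suc) (ℕ.suc-injective eq) i
sum-full (suc (suc _) ∷ v) le eq i       = contradiction (le zero) λ where (s≤s ())

sum-ones : ∀ {n} (v : Vec ℕ n) → (∀ i → lookup v i ≡ 1) → Vec.sum v ≡ n
sum-ones []      eq = refl
sum-ones (x ∷ v) eq = cong₂ _+_ (eq zero) (sum-ones v (eq ∘ suc))

lookup-injective : ∀ {A : Set} {n} {v w : Vec A n} → (∀ i → lookup v i ≡ lookup w i) → v ≡ w
lookup-injective {v = v} {w} eq =
  trans (sym (Vec.tabulate∘lookup v)) (trans (Vec.tabulate-cong eq) (Vec.tabulate∘lookup w))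

module _ {n s : ℕ} where

  -- Compares the data only, so that the proofs inside either record never enter an equation.
  record Describes (p : RC n s) (P : Placement n s) : Set where
    open Placement P
    field
      describes-μ : ∀ i → lookup (RC.μ p) i ≡ s + height steps i
      describes-C : ∀ i → lookup (RC.C p) i ≡ ⁅ Fin.join s n (column i) ⁆

  rc⇒placement : (p : RC n s) → ∃[ P ] Describes p P
  rc⇒placement p = record
    { steps = steps ; column = column
    ; column-injective = λ {i} {i′} eq → colwise i i′ _ (column-∈ i)
        (subst (λ y → Fin.join s n y ∈ lookup C i′) (sym eq) (column-∈ i′))
    ; column-before = λ {i} {j} eq → <height⇒before steps (ℕ.+-cancelˡ-< s _ _
        (subst₂ _<_ (Fin.toℕ-↑ʳ s j) (μ-height i)
          (onBoard i (s ↑ʳ j) (subst (λ y → Fin.join s n y ∈ lookup C i) eq (column-∈ i))))) }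
    , record { describes-μ = μ-height ; describes-C = C-column }
    where
    open RC p
    open IsBoard isBoard
    open IsRookPlacement isPlacement

    -- The first s columns belong to every row, so only the excess over s shapes the path.
    heights = fromHeights n n (cong (n +_) (sym (ℕ.+-identityʳ n))) (λ i → lookup μ i ∸ s)
      (λ i i′ le → ℕ.∸-monoˡ-≤ s (monotone i i′ le))
      (λ i → ℕ.≤-trans (ℕ.∸-monoˡ-≤ s (upper i)) (ℕ.≤-reflexive (ℕ.m+n∸m≡n s n)))
    steps = proj₁ heights

    μ-height : ∀ i → lookup μ i ≡ s + height steps i
    μ-height i = trans (sym (ℕ.m+[n∸m]≡n (lower i))) (cong (s +_) (sym (proj₂ heights i)))

    row≤1 : ∀ i → ∣ lookup C i ∣ ≤ 1
    row≤1 i with Sub.nonempty? (lookup C i)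
    ... | yes (x , x∈) = ℕ.≤-trans
      (Sub.p⊆q⇒∣p∣≤∣q∣ λ y∈ → subst (_∈ ⁅ x ⁆) (rowwise i _ _ x∈ y∈) (Sub.x∈⁅x⁆ x))
      (ℕ.≤-reflexive (Sub.∣⁅x⁆∣≡1 x))
    ... | no empty = ℕ.≤-trans (ℕ.≤-reflexive
      (trans (cong ∣_∣ (Sub.Empty-unique empty)) (Sub.∣⊥∣≡0 (s + n)))) z≤n

    rook : ∀ i → ∃[ x ] x ∈ lookup C i
    rook i with Sub.nonempty? (lookup C i)
    ... | yes found = found
    ... | no empty = contradiction
      (trans (Vec.lookup-map i ∣_∣ C) (trans (cong ∣_∣ (Sub.Empty-unique empty)) (Sub.∣⊥∣≡0 (s + n))))
      (sum-full (Vec.map ∣_∣ C) (λ i → subst (_≤ 1) (sym (Vec.lookup-map i ∣_∣ C)) (row≤1 i)) rookCount i)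

    column : Fin n → Fin s ⊎ Fin n
    column i = Fin.splitAt s (proj₁ (rook i))

    column-∈ : ∀ i → Fin.join s n (column i) ∈ lookup C i
    column-∈ i = subst (_∈ lookup C i) (sym (Fin.join-splitAt s n (proj₁ (rook i)))) (proj₂ (rook i))

    C-column : ∀ i → lookup C i ≡ ⁅ Fin.join s n (column i) ⁆
    C-column i = Sub.⊆-antisym
      (λ y∈ → subst (_∈ ⁅ Fin.join s n (column i) ⁆) (rowwise i _ _ (column-∈ i) y∈) (Sub.x∈⁅x⁆ _))
      (λ y∈ → subst (_∈ lookup C i) (sym (Sub.x∈⁅y⁆⇒x≡y _ y∈)) (column-∈ i))

  join-injective : ∀ {y y′} → Fin.join s n y ≡ Fin.join s n y′ → y ≡ y′
  join-injective {y} {y′} eq =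
    trans (sym (Fin.splitAt-join s n y)) (trans (cong (Fin.splitAt s) eq) (Fin.splitAt-join s n y′))

  placement⇒rc : (P : Placement n s) → ∃[ p ] Describes p P
  placement⇒rc P = record
    { μ = μ ; C = C
    ; isBoard = record
      { lower    = λ i → subst (s ≤_) (sym (μ-height i)) (ℕ.m≤m+n s _)
      ; monotone = λ i i′ le → subst₂ _≤_ (sym (μ-height i)) (sym (μ-height i′))
                                 (ℕ.+-monoʳ-≤ s (height-monotone steps i i′ le))
      ; upper    = λ i → subst (_≤ s + n) (sym (μ-height i)) (ℕ.+-monoʳ-≤ s (height-≤ steps i)) }
    ; isPlacement = record
      { onBoard   = λ i j j∈ → subst₂ _<_ (cong toℕ (sym (∈⇒≡ i j∈))) (sym (μ-height i)) (under i (column i) refl)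
      ; rowwise   = λ i j j′ j∈ j′∈ → trans (∈⇒≡ i j∈) (sym (∈⇒≡ i j′∈))
      ; colwise   = λ i i′ j j∈ j∈′ → column-injective (join-injective (trans (sym (∈⇒≡ i j∈)) (∈⇒≡ i′ j∈′)))
      ; rookCount = sum-ones (Vec.map ∣_∣ C) λ i →
          trans (Vec.lookup-map i ∣_∣ C) (trans (cong ∣_∣ (C-column i)) (Sub.∣⁅x⁆∣≡1 (Fin.join s n (column i)))) } }
    , record { describes-μ = μ-height ; describes-C = C-column }
    where
    open Placement P
    μ : Vec ℕ n
    μ = tabulate λ i → s + height steps i
    C : Squares n (s + n)
    C = tabulate λ i → ⁅ Fin.join s n (column i) ⁆

    μ-height : ∀ i → lookup μ i ≡ s + height steps i
    μ-height = Vec.lookup∘tabulate _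

    C-column : ∀ i → lookup C i ≡ ⁅ Fin.join s n (column i) ⁆
    C-column = Vec.lookup∘tabulate _

    ∈⇒≡ : ∀ i {j} → j ∈ lookup C i → j ≡ Fin.join s n (column i)
    ∈⇒≡ i {j} j∈ = Sub.x∈⁅y⁆⇒x≡y _ (subst (j ∈_) (C-column i) j∈)

    under : ∀ i y → column i ≡ y → toℕ (Fin.join s n y) < s + height steps i
    under i (inj₁ c) eq = ℕ.<-≤-trans (subst (_< s) (sym (Fin.toℕ-↑ˡ c n)) (Fin.toℕ<n c)) (ℕ.m≤m+n s _)
    under i (inj₂ j) eq = subst (_< s + height steps i) (sym (Fin.toℕ-↑ʳ s j))
      (ℕ.+-monoʳ-< s (before⇒<height steps (column-before eq)))

  module _ {p q : RC n s} {P Q : Placement n s} (dP : Describes p P) (dQ : Describes q Q) where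
    private
      module P = Placement P
      module Q = Placement Q
      open Describes

    same⇒letters : (RC.μ p , RC.C p) ≡ (RC.μ q , RC.C q) → ∀ x → P.letter x ≡ Q.letter x
    same⇒letters eq = columns⇒letters P Q
      (height-injective P.steps Q.steps λ i → ℕ.+-cancelˡ-≡ s _ _
        (trans (sym (describes-μ dP i)) (trans (cong (λ z → lookup (proj₁ z) i) eq) (describes-μ dQ i))))
      (λ i → join-injective (Sub.x∈⁅y⁆⇒x≡y _ (subst (Fin.join s n (P.column i) ∈_)
        (trans (sym (describes-C dP i)) (trans (cong (λ z → lookup (proj₂ z) i) eq) (describes-C dQ i)))
        (Sub.x∈⁅x⁆ _))))

    letters⇒same : (∀ x → P.letter x ≡ Q.letter x) → (RC.μ p , RC.C p) ≡ (RC.μ q , RC.C q)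
    letters⇒same eq = cong₂ _,_
      (lookup-injective λ i → trans (describes-μ dP i)
        (trans (cong (λ t → s + height t i) (letters⇒steps P Q eq)) (sym (describes-μ dQ i))))
      (lookup-injective λ i → trans (describes-C dP i)
        (trans (cong (λ y → ⁅ Fin.join s n y ⁆) (letters⇒column P Q eq i)) (sym (describes-C dQ i))))

  -- A column c among the first s holds a rook exactly when the row of that rook has the letter
  -- `up c`.
  rooks≡labels : ∀ {p : RC n s} {P : Placement n s} → Describes p P →
                 rooksInFirstColumns p ≡ ∣ labels (Placement.letter P) ∣
  rooks≡labels {p} {P} d = trans (sym (∣occupied∣ (Vec.map (take s) C) colwise′)) (cong ∣_∣ (Sub.⊆-antisym to from))
    where
    open RC p
    open IsRookPlacement isPlacement
    open Placement P
    open Describes d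

    ∈-take⁻ : ∀ {i c} → c ∈ lookup (Vec.map (take s) C) i → (c ↑ˡ n) ∈ lookup C i
    ∈-take⁻ {i} {c} c∈ = Vec.lookup⇒[]= (c ↑ˡ n) (lookup C i) (trans (sym (lookup-take-↑ˡ s (lookup C i) c))
      (trans (cong (λ v → lookup v c) (sym (Vec.lookup-map i (take s) C))) (Vec.[]=⇒lookup c∈)))

    ∈-take⁺ : ∀ {i c} → (c ↑ˡ n) ∈ lookup C i → c ∈ lookup (Vec.map (take s) C) i
    ∈-take⁺ {i} {c} c∈ = Vec.lookup⇒[]= c (lookup (Vec.map (take s) C) i)
      (trans (cong (λ v → lookup v c) (Vec.lookup-map i (take s) C))
        (trans (lookup-take-↑ˡ s (lookup C i) c) (Vec.[]=⇒lookup c∈)))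

    colwise′ : ∀ i i′ c → c ∈ lookup (Vec.map (take s) C) i → c ∈ lookup (Vec.map (take s) C) i′ → i ≡ i′
    colwise′ i i′ c a b = colwise i i′ (c ↑ˡ n) (∈-take⁻ a) (∈-take⁻ b)

    to : occupied (Vec.map (take s) C) Sub.⊆ labels letter
    to {c} c∈ with i , c∈i ← ∈-occupied⁻ (Vec.map (take s) C) c∈ =
      ∈-labels⁺ letter (letter-placed (row-up (sym (join-injective {inj₁ c} {column i}
        (Sub.x∈⁅y⁆⇒x≡y _ (subst ((c ↑ˡ n) ∈_) (describes-C i) (∈-take⁻ c∈i)))))))

    from : labels letter Sub.⊆ occupied (Vec.map (take s) C)
    from {c} c∈ with x , eq ← ∈-labels⁻ letter c∈ = go (at steps x) (placed-letter eq)
      where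
      go : ∀ y → Placed y (up c) → c ∈ occupied (Vec.map (take s) C)
      go (inj₁ i) (row-up e) = ∈-occupied⁺ (Vec.map (take s) C) i (∈-take⁺ (subst ((c ↑ˡ n) ∈_)
        (sym (trans (describes-C i) (cong (λ y → ⁅ Fin.join s n y ⁆) e))) (Sub.x∈⁅x⁆ _)))

-- The bijection.

labels-cong : ∀ {m s} {letter letter′ : Fin m → Letter m s} → (∀ i → letter i ≡ letter′ i) →
              labels letter ≡ labels letter′
labels-cong {letter = letter} {letter′} eq = Sub.⊆-antisym
  (λ c∈ → let i , p = ∈-labels⁻ letter c∈ in ∈-labels⁺ letter′ (trans (sym (eq i)) p))
  (λ c∈ → let i , p = ∈-labels⁻ letter′ c∈ in ∈-labels⁺ letter (trans (eq i) p))

realizes-resp : ∀ {n s} {V : Subset s} (M : TreeRootedMap n (vertexSet V))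
                {letter letter′ : Fin (2 * n) → Letter (2 * n) s} → (∀ i → letter i ≡ letter′ i) →
                Reading.Realizes M letter → Reading.Realizes M letter′
realizes-resp M eq r = record
  { φ = φ ; φ-first = φ-first ; φ-tour = φ-tour
  ; reads = λ i → subst (Reading.Reads M φ (φ ⟨$⟩ʳ i)) (eq i) (reads i) }
  where open Reading.Realizes r

corollary3p2 : (n s k : ℕ) → Bijection (RCₖ n s k) (TreeRootedMaps n s k)
corollary3p2 n s k = record
  { to = toMap
  ; cong = λ {x} {y} → toMap-cong {x} {y}
  ; bijective = (λ {x} {y} → injective {x} {y}) , surjective
  }
  where
  open Setoid (RCₖ n s k) using () renaming (Carrier to Placements; _≈_ to _≈ₚ_)
  open Setoid (TreeRootedMaps n s k) using () renaming (_≈_ to _≈ₘ_)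
  open LabelledTreeRootedMap

  placement : Placements → Placement n s
  placement (p , _) = proj₁ (rc⇒placement p)

  describes : (x : Placements) → Describes (proj₁ x) (placement x)
  describes (p , _) = proj₂ (rc⇒placement p)

  letterOf : Placements → Fin (2 * n) → Letter (2 * n) s
  letterOf x = Placement.letter (placement x)

  isCodeOf : ∀ x → IsCode (letterOf x)
  isCodeOf x = Placement.isCode (placement x)

  toMap : Placements → LabelledTreeRootedMap n s k
  toMap x = record
    { V = labels (letterOf x) ; ∣V∣≡k = trans (sym (rooks≡labels (describes x))) (proj₂ x)
    ; map = ContourMap.treeRootedMap {n} (isCodeOf x) }

  -- Serves both congruence and surjectivity: in the first case y is another contour map, in the
  -- second an arbitrary map.
  matches : ∀ x (y : LabelledTreeRootedMap n s k) {letter} → (∀ i → letter i ≡ letterOf x i) →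
            Reading.Realizes (map y) letter → toMap x ≈ₘ y
  matches x y eq r =
    sym (Reading.labels-realized (map y) r′) , realizes⇒iso (map y) (isCodeOf x) r′
    where r′ = realizes-resp (map y) eq r

  toMap-cong : ∀ {x y} → x ≈ₚ y → toMap x ≈ₘ toMap y
  toMap-cong {x} {y} eq = matches x (toMap y)
    (λ i → sym (same⇒letters (describes x) (describes y) eq i)) (contourMap-realizes (isCodeOf y))

  injective : ∀ {x y} → toMap x ≈ₘ toMap y → x ≈ₚ y
  injective {x} {y} (_ , iso) = letters⇒same (describes x) (describes y)
    (iso⇒letters iso (contourMap-realizes (isCodeOf x)) (contourMap-realizes (isCodeOf y)))

  surjective : ∀ y → ∃[ x ] (∀ {z} → z ≈ₚ x → toMap z ≈ₘ y)
  -- `toMap z` recomputes a placement from z; it is compared with P only through letters, which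
  -- their descriptions force to agree.
  surjective y = (p , rooks) , λ {z} eq → matches z y
      (λ i → trans (sym (placement-letter {n} code i)) (sym (same⇒letters (describes z) d eq i))) r
    where
    letter = proj₁ (Reading.realization (map y))
    r = proj₂ (Reading.realization (map y))
    code = Reading.realizes⇒isCode (map y) r
    P = code⇒placement {n} code
    p = proj₁ (placement⇒rc P)
    d = proj₂ (placement⇒rc P)
    rooks : rooksInFirstColumns p ≡ k
    rooks = begin
      rooksInFirstColumns p           ≡⟨ rooks≡labels d ⟩
      ∣ labels (Placement.letter P) ∣ ≡⟨ cong ∣_∣ (labels-cong {letter = Placement.letter P} {letter} (placement-letter {n} code)) ⟩
      ∣ labels letter ∣               ≡⟨ cong ∣_∣ (Reading.labels-realized (map y) r) ⟨
      ∣ V y ∣                         ≡⟨ ∣V∣≡k y ⟩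
      k                               ∎
      where open ≡-Reasoning
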